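{- Let $q$ be a power of a prime $p$, let $D\subseteq\mathbb{F}_q$ with $|D|=n$, $0\notin D$, and $D\cup\{0\}$ an additive subgroup of $\mathbb{F}_q$. Let $k,r\ge0$ be integers, $\gamma\in\mathbb{F}_q$, and write $T=q^{k-r}\binom{n}{r}\sum_{j=0}^{k-r}(-q)^{ -j}\binom{n-r}{j}$. (a) If $\gamma\in D$, then $$N(x^{k+1}+\gamma x^k,r)=T+\frac{1}{n+1}(-1)^{k+1-r}\binom{n}{r}\binom{n-r}{k+1-r}-\frac{1}{n+1}(-1)^r\binom{k+1}{r}\sum_{0\le j\le (k+1)/p}(-1)^j\binom{(n+1)/p}{j}.$$ (b) If $\gamma\notin D\cup\{0\}$, then $N(x^{k+1}+\gamma x^k,r)=T$. (c) If $\gamma=0$, then $$N(x^{k+1}+\gamma x^k,r)=T+\frac{1}{n+1}(-1)^{k+1-r}\binom{n}{r}\binom{n-r}{k+1-r}+\frac{n}{n+1}(-1)^r\binom{k+1}{r}\sum_{0\le j\le (k+1)/p}(-1)^j\binom{(n+1)/p}{j}.$$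
   Context: $N(x^{k+1}+\gamma x^k,r)$ denotes the number of monic polynomials $g$ of degree $k+1$ over $\mathbb{F}_q$ whose coefficient of $x^k$ equals $\gamma$ and such that exactly $r$ elements $\alpha\in D$ satisfy $(x+\alpha)\mid g$. Binomial coefficients with out-of-range lower index are $0$ and empty sums are $0$. -}

module Defs where

open import Level using (0ℓ)
open import Data.Nat as ℕ using (ℕ; zero; suc)
open import Data.Nat.Combinatorics using (_C_)
open import Data.Fin using (Fin)
open import Data.Unit using (⊤)
open import Data.Integer as ℤ using (ℤ; +_; -[1+_])
open import Data.Rational as ℚ using (ℚ; 0ℚ; 1ℚ)
open import Data.Rational.Properties as ℚP using ()
open import Data.List using (List; []; _∷_; map; length; _++_)
open import Data.List.Membership.Propositional using (_∈_)
open import Data.List.Relation.Unary.Unique.Propositional using (Unique)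
open import Data.Vec using (Vec; toList)
open import Data.Product using (Σ; ∃; _×_; _,_)
open import Function.Bundles using (_↔_; _⇔_)
open import Relation.Binary.PropositionalEquality using (_≡_; _≢_)
open import Relation.Nullary using (yes; no)
open import Algebra.Core using (Op₁; Op₂)
open import Algebra.Structures using (IsCommutativeRing)

ℕ→ℚ : ℕ → ℚ
ℕ→ℚ n = (+ n) ℚ./ 1

record FiniteField : Set₁ where
  infixl 7 _*_
  infixl 6 _+_
  field
    Carrier  : Set
    _+_ _*_  : Op₂ Carrier
    -_       : Op₁ Carrier
    0# 1#    : Carrier
    isCommutativeRing : IsCommutativeRing _≡_ _+_ _*_ -_ 0# 1#
    0≢1      : 0# ≢ 1#
    inverse  : ∀ x → x ≢ 0# → ∃ λ y → x * y ≡ 1#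
    size     : ℕ
    enum     : Carrier ↔ Fin size

  natElt : ℕ → Carrier
  natElt zero    = 0#
  natElt (suc n) = 1# + natElt n

HasSize : {A : Set} → (A → Set) → ℕ → Set
HasSize {A} P m =
  Σ (List A) λ L → Unique L × (∀ x → P x ⇔ (x ∈ L)) × length L ≡ m

-- Polynomials over a finite field, as coefficient lists (constant term
-- first); equality of polynomials is equality up to trailing zeros.

module Poly (F : FiniteField) where
  open FiniteField F

  Pol : Set
  Pol = List Carrier

  _+ₚ_ : Pol → Pol → Pol
  []       +ₚ q        = q
  (a ∷ p)  +ₚ []       = a ∷ p
  (a ∷ p)  +ₚ (b ∷ q)  = (a + b) ∷ (p +ₚ q)

  _*ₚ_ : Pol → Pol → Pol
  []      *ₚ q = []
  (a ∷ p) *ₚ q = map (a *_) q +ₚ (0# ∷ (p *ₚ q))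

  _≈ₚ_ : Pol → Pol → Set
  []      ≈ₚ []      = ⊤
  []      ≈ₚ (b ∷ q) = (b ≡ 0#) × ([] ≈ₚ q)
  (a ∷ p) ≈ₚ []      = (a ≡ 0#) × (p ≈ₚ [])
  (a ∷ p) ≈ₚ (b ∷ q) = (a ≡ b) × (p ≈ₚ q)

  _∣ₚ_ : Pol → Pol → Set
  f ∣ₚ g = ∃ λ h → (f *ₚ h) ≈ₚ g

  xPlus : Carrier → Pol
  xPlus α = α ∷ 1# ∷ []

  monicWith : {k : ℕ} → Carrier → Vec Carrier k → Pol
  monicWith γ c = toList c ++ (γ ∷ 1# ∷ [])

  ExactlyRootsIn : List Carrier → Pol → ℕ → Set
  ExactlyRootsIn D g r = HasSize (λ α → (α ∈ D) × (xPlus α ∣ₚ g)) r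

  -- "N(x^(k+1) + γ x^k , r) = v": the number of monic g of degree k+1 with
  -- x^k-coefficient γ (parametrised by their remaining k coefficients)
  -- having exactly r such α ∈ D is a natural number whose value is v.
  NIs : List Carrier → (k : ℕ) → Carrier → (r : ℕ) → ℚ → Set
  NIs D k γ r v =
    Σ ℕ λ N → HasSize (λ (c : Vec Carrier k) → ExactlyRootsIn D (monicWith γ c) r) N
            × (ℕ→ℚ N ≡ v)

-- multiplicative inverse in ℚ (only ever applied to nonzero values; 0⁻¹ := 0)
inv : ℚ → ℚ
inv x with x ℚP.≟ 0ℚ
... | yes _  = 0ℚ
... | no x≢0 = ℚ.1/_ x {{ℚ.≢-nonZero x≢0}}

_^ℚ_ : ℚ → ℕ → ℚ
x ^ℚ zero  = 1ℚ
x ^ℚ suc n = x ℚ.* (x ^ℚ n)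

_^ℤ_ : ℚ → ℤ → ℚ
x ^ℤ (+ n)      = x ^ℚ n
x ^ℤ -[1+ n ]   = inv (x ^ℚ suc n)

sumTerms : ℕ → (ℕ → ℚ) → ℚ
sumTerms zero    f = 0ℚ
sumTerms (suc m) f = sumTerms m f ℚ.+ f m

binomℤ : ℕ → ℤ → ℕ
binomℤ n (+ k)     = n C k
binomℤ n -[1+ _ ]  = 0

sgn : ℤ → ℚ
sgn e = (ℚ.- 1ℚ) ^ℤ e

-- floor division of naturals (a / 0 := 0, never used since p is prime)
_div_ : ℕ → ℕ → ℕ
a div zero    = 0
a div (suc b) = a ℕ./ suc b

-- T = q^(k-r) C(n,r) Σ_{j=0}^{k-r} (-q)^(-j) C(n-r, j)
-- (exponent k-r is an integer; the sum is empty when k < r)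
Tval : (q n k r : ℕ) → ℚ
Tval q n k r =
  (ℕ→ℚ q ^ℤ (k ℤ.⊖ r)) ℚ.* ℕ→ℚ (n C r) ℚ.*
  sumTerms (suc k ℕ.∸ r) (λ j →
    ((ℚ.- ℕ→ℚ q) ^ℤ (ℤ.- (+ j))) ℚ.* ℕ→ℚ ((n ℕ.∸ r) C j))

Aval : (n k r : ℕ) → ℚ
Aval n k r =
  inv (ℕ→ℚ (suc n)) ℚ.* sgn (suc k ℤ.⊖ r) ℚ.* ℕ→ℚ (n C r)
    ℚ.* ℕ→ℚ (binomℤ (n ℕ.∸ r) (suc k ℤ.⊖ r))

Bval : (p n k r : ℕ) → ℚ
Bval p n k r =
  sgn (+ r) ℚ.* ℕ→ℚ (suc k C r) ℚ.*
  sumTerms (suc (suc k div p)) (λ j → sgn (+ j) ℚ.* ℕ→ℚ ((suc n div p) C j))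

-- Hypotheses on D ⊆ F (given as a duplicate-free list).

module _ (F : FiniteField) where
  open FiniteField F
  open import Data.Sum using (_⊎_)

  InD∪0 : List Carrier → Carrier → Set
  InD∪0 D a = (a ≡ 0#) ⊎ (a ∈ D)

  -- D ∪ {0} is an additive subgroup of F (it contains 0 by construction)
  D∪0IsAddSubgroup : List Carrier → Set
  D∪0IsAddSubgroup D =
    (∀ a b → InD∪0 D a → InD∪0 D b → InD∪0 D (a + b)) ×
    (∀ a → InD∪0 D a → InD∪0 D (- a))

{-# OPTIONS --safe #-}
module Submission where

-- Dividing by X + d turns the monic polynomials of degree m with next coefficient γ that have the
-- root −d into those of degree m − 1 with next coefficient γ − d.  Hence, writing N_r(L, m, γ) for the
-- number of such polynomials with exactly r roots −α, α ∈ L, and d ∉ L,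
--   N_r(d ∷ L, m, γ) = N_r(L, m, γ) − N_r(L, m−1, γ−d) + N_{r−1}(L, m−1, γ−d),
-- and induction on L gives N_r = T + (−1)^{m−r} C(m,r) s_m(γ), where s_m(γ) is the number of
-- m-subsets of L with sum γ.
--
-- For L = D and G = D ∪ {0}, s_m vanishes outside G and its sum over G is C(n,m), so it remains to
-- compute s_m(0) − s_m(γ) for γ ∈ D.  Let E_{d,m}(γ) count the m-subsets of D that contain d and have
-- sum γ.  Then Σ_d E_{d,m}(γ) = m s_m(γ) and E_{d,m+1}(γ) = s_m(γ−d) − E_{d,m}(γ−d).  Put
-- A_i(m, γ) = Σ_d E_{d,m}(γ − i d).  For p ∤ i + 1 the map g ↦ γ − (i+1) g permutes G, so
-- A_i(m+1, γ) = C(n,m) − s_m(γ) − A_{i+1}(m, γ); and A_{p−1}(m+1, γ) = (n − m) s_m(γ) because p d = 0.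
-- For the differences between 0 and γ these relations form a closed recurrence of period p, which
-- determines s_m(0) − s_m(γ) and also shows that p divides n + 1.

open import Defs
open import Algebra.Bundles using (CommutativeRing)
import Algebra.Properties.AbelianGroup as AbelianGroupProperties
import Algebra.Properties.Semiring.Mult as SemiringMult
import Algebra.Solver.Ring.NaturalCoefficients.Default as SemiringSolver
open import Data.Fin using (Fin)
import Data.Fin.Properties as FinP
open import Data.Integer as ℤ using (ℤ; +_; 0ℤ; 1ℤ; -1ℤ)
import Data.Integer.Divisibility.Signed as ℤ∣
import Data.Integer.Properties as ℤP
open import Data.Integer.Tactic.RingSolver using (solve-∀)
open import Data.List using (List; []; _∷_; map; length; filter; allFin; cartesianProductWith)
open import Data.List.Membership.Propositional using (_∈_; _∉_)
open import Data.List.Membership.Propositional.Properties using (∈-map⁺; ∈-map⁻; ∈-filter⁺; ∈-filter⁻; ∈-cartesianProductWith⁺; ∈-allFin)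
open import Data.List.Membership.Propositional.Properties.WithK using (unique∧set⇒bag)
import Data.List.Properties as ListP
open import Data.List.Relation.Binary.BagAndSetEquality using (∼bag⇒↭)
open import Data.List.Relation.Binary.Permutation.Propositional as Perm using (_↭_)
open import Data.List.Relation.Binary.Permutation.Propositional.Properties using (↭-length)
open import Data.List.Relation.Unary.All using ([]; tabulate)
open import Data.List.Relation.Unary.AllPairs using ([]; _∷_)
open import Data.List.Relation.Unary.Any using (here; there)
open import Data.List.Relation.Unary.Unique.Propositional using (Unique)
import Data.List.Relation.Unary.Unique.Propositional.Properties as UniqueP
open import Data.Nat as ℕ using (ℕ; zero; suc; z≤n; s≤s; _^_; _≤_)
open import Data.Nat.Combinatorics using (_C_; nCk+nC[k+1]≡[n+1]C[k+1]; k>n⇒nCk≡0)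
open import Data.Nat.Coprimality using (coprime-Bézout; prime⇒coprime)
open import Data.Nat.Divisibility using (_∣_)
import Data.Nat.DivMod as ℕD
open import Data.Nat.GCD using (module Bézout)
open import Data.Nat.Primality using (Prime; ¬prime[0])
import Data.Nat.Properties as ℕP
open import Data.Product using (∃; _×_; _,_; proj₁; proj₂)
open import Data.Rational as ℚ using (ℚ; 0ℚ; 1ℚ)
import Data.Rational.Properties as ℚP
open import Data.Rational.Solver using (module +-*-Solver)
open import Data.Rational.Unnormalised as ℚᵘ using (mkℚᵘ; *≡*)
import Data.Rational.Unnormalised.Properties as ℚᵘP
open import Data.Sum using (inj₁; inj₂)
open import Data.Unit using (tt)
open import Data.Vec using (Vec; []; _∷_)
import Data.Vec.Properties as VecP
open import Function using (_∘_)
open import Function.Bundles using (Equivalence; Inverse; mk⇔)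
open import Function.Properties.Inverse using (↔⇒↣)
open import Relation.Binary.Definitions using (DecidableEquality)
open import Relation.Binary.PropositionalEquality using (_≡_; _≢_; refl; sym; trans; cong; cong₂; subst; module ≡-Reasoning)
open import Relation.Nullary using (¬_; Dec; yes; no; contradiction)
open import Relation.Nullary.Decidable using (via-injection)
open import Relation.Unary using (Decidable)

open ≡-Reasoning

-- Sums over lists, reindexing and indicators.

module _ where
  open import Data.Integer using (_+_; _*_; -_; _-_)

  +-congˡ : ∀ a {b c} → b ≡ c → a + b ≡ a + c
  +-congˡ a = cong (λ t → a + t)

  private variable
    A B : Set
    P Q : Set

  sumOver : List A → (A → ℤ) → ℤ
  sumOver []       f = 0ℤ
  sumOver (x ∷ xs) f = f x + sumOver xs f

  sumOver-cong : (xs : List A) {f g : A → ℤ} → (∀ x → x ∈ xs → f x ≡ g x) → sumOver xs f ≡ sumOver xs g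
  sumOver-cong []       h = refl
  sumOver-cong (x ∷ xs) h = cong₂ _+_ (h x (here refl)) (sumOver-cong xs (λ y y∈ → h y (there y∈)))

  sumOver-+ : (xs : List A) (f g : A → ℤ) → sumOver xs (λ x → f x + g x) ≡ sumOver xs f + sumOver xs g
  sumOver-+ []       f g = refl
  sumOver-+ (x ∷ xs) f g = begin
    f x + g x + sumOver xs (λ x → f x + g x)          ≡⟨ cong (λ t → f x + g x + t) (sumOver-+ xs f g) ⟩
    f x + g x + (sumOver xs f + sumOver xs g)          ≡⟨ lemma (f x) (g x) _ _ ⟩
    f x + sumOver xs f + (g x + sumOver xs g)          ∎
    where
    lemma : ∀ a b c d → a + b + (c + d) ≡ a + c + (b + d)
    lemma = solve-∀

  sumOver-neg : (xs : List A) (f : A → ℤ) → sumOver xs (λ x → - f x) ≡ - sumOver xs f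
  sumOver-neg []       f = refl
  sumOver-neg (x ∷ xs) f =
    trans (cong (λ t → - f x + t) (sumOver-neg xs f)) (sym (ℤP.neg-distrib-+ (f x) (sumOver xs f)))

  sumOver-minus : (xs : List A) (f g : A → ℤ) → sumOver xs (λ x → f x - g x) ≡ sumOver xs f - sumOver xs g
  sumOver-minus xs f g = trans (sumOver-+ xs f (λ x → - g x)) (+-congˡ (sumOver xs f) (sumOver-neg xs g))

  sumOver-const : (xs : List A) (c : ℤ) → sumOver xs (λ _ → c) ≡ + length xs * c
  sumOver-const []       c = sym (ℤP.*-zeroˡ c)
  sumOver-const (x ∷ xs) c = trans (+-congˡ c (sumOver-const xs c)) (lemma (+ length xs) c)
    where
    lemma : ∀ l c → c + l * c ≡ (1ℤ + l) * c
    lemma = solve-∀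

  sumOver-zero : (xs : List A) {f : A → ℤ} → (∀ x → x ∈ xs → f x ≡ 0ℤ) → sumOver xs f ≡ 0ℤ
  sumOver-zero []       h = refl
  sumOver-zero (x ∷ xs) h = cong₂ _+_ (h x (here refl)) (sumOver-zero xs (λ y y∈ → h y (there y∈)))

  sumOver-map : (φ : A → B) (xs : List A) (f : B → ℤ) → sumOver (map φ xs) f ≡ sumOver xs (f ∘ φ)
  sumOver-map φ []       f = refl
  sumOver-map φ (x ∷ xs) f = +-congˡ (f (φ x)) (sumOver-map φ xs f)

  sumOver-↭ : {xs ys : List A} (f : A → ℤ) → xs ↭ ys → sumOver xs f ≡ sumOver ys f
  sumOver-↭ f Perm.refl = refl
  sumOver-↭ f (Perm.prep x p) = +-congˡ (f x) (sumOver-↭ f p)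
  sumOver-↭ f (Perm.swap x y p) = trans (cong (λ t → f x + (f y + t)) (sumOver-↭ f p)) (lemma (f x) (f y) _)
    where
    lemma : ∀ a b c → a + (b + c) ≡ b + (a + c)
    lemma = solve-∀
  sumOver-↭ f (Perm.trans p q) = trans (sumOver-↭ f p) (sumOver-↭ f q)

  -- In a duplicate-free list each membership has a single proof, so equality as sets is already
  -- equality as bags, which is a permutation.
  unique-↭ : {xs ys : List A} → Unique xs → Unique ys →
             (∀ {x} → x ∈ xs → x ∈ ys) → (∀ {x} → x ∈ ys → x ∈ xs) → xs ↭ ys
  unique-↭ ux uy f g = ∼bag⇒↭ (unique∧set⇒bag ux uy (mk⇔ f g))

  -- Injectivity keeps `map φ xs` duplicate-free; `into` and `onto` give it the members of `ys`, so
  -- the two lists are permutations of each other.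
  sumOver-bijection : {xs : List A} {ys : List B} → Unique xs → Unique ys →
    (φ : A → B) → (∀ {x y} → φ x ≡ φ y → x ≡ y) →
    (∀ {x} → x ∈ xs → φ x ∈ ys) → (∀ {y} → y ∈ ys → ∃ λ x → x ∈ xs × y ≡ φ x) →
    (f : B → ℤ) → sumOver xs (f ∘ φ) ≡ sumOver ys f
  sumOver-bijection {xs = xs} {ys} ux uy φ inj into onto f =
    trans (sym (sumOver-map φ xs f))
          (sumOver-↭ f (unique-↭ (UniqueP.map⁺ inj ux) uy to from))
    where
    to : ∀ {y} → y ∈ map φ xs → y ∈ ys
    to y∈ with ∈-map⁻ φ y∈
    ... | x , x∈ , refl = into x∈
    from : ∀ {y} → y ∈ ys → y ∈ map φ xs
    from y∈ with onto y∈
    ... | x , x∈ , refl = ∈-map⁺ φ x∈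

  indicator : Dec P → ℤ
  indicator (yes _) = 1ℤ
  indicator (no  _) = 0ℤ

  indicator-cong : (d : Dec P) (d′ : Dec Q) → (P → Q) → (Q → P) → indicator d ≡ indicator d′
  indicator-cong (yes _) (yes _) f g = refl
  indicator-cong (yes x) (no ¬y) f g = contradiction (f x) ¬y
  indicator-cong (no ¬x) (yes y) f g = contradiction (g y) ¬x
  indicator-cong (no _)  (no _)  f g = refl

  indicator-no : (d : Dec P) → ¬ P → indicator d ≡ 0ℤ
  indicator-no (yes x) ¬x = contradiction x ¬x
  indicator-no (no _)  ¬x = refl

  indicator-yes : (d : Dec P) → P → indicator d ≡ 1ℤ
  indicator-yes (yes _) x = refl
  indicator-yes (no ¬x) x = contradiction x ¬x

  length-filter : {R : A → Set} (R? : Decidable R) (xs : List A) →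
    + length (filter R? xs) ≡ sumOver xs (indicator ∘ R?)
  length-filter R? [] = refl
  length-filter R? (x ∷ xs) with R? x
  ... | yes _ = cong (λ t → 1ℤ + t) (length-filter R? xs)
  ... | no  _ = trans (length-filter R? xs) (sym (ℤP.+-identityˡ _))

  sumOver-filter : {R : A → Set} (R? : Decidable R) (xs : List A) (f : A → ℤ) →
    sumOver (filter R? xs) f ≡ sumOver xs (λ x → indicator (R? x) * f x)
  sumOver-filter R? [] f = refl
  sumOver-filter R? (x ∷ xs) f with R? x
  ... | yes _ = cong₂ _+_ (sym (ℤP.*-identityˡ (f x))) (sumOver-filter R? xs f)
  ... | no  _ = trans (sumOver-filter R? xs f)
    (trans (sym (ℤP.+-identityˡ _)) (cong (_+ sumOver xs (λ y → indicator (R? y) * f y)) (sym (ℤP.*-zeroˡ (f x)))))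

  -- Signs, binomial coefficients and alternating binomial sums.

  sign : ℕ → ℤ
  sign zero    = 1ℤ
  sign (suc n) = - sign n

  sign-+ : ∀ m n → sign (m ℕ.+ n) ≡ sign m * sign n
  sign-+ zero    n = sym (ℤP.*-identityˡ (sign n))
  sign-+ (suc m) n = trans (cong -_ (sign-+ m n)) (ℤP.neg-distribˡ-* (sign m) (sign n))

  sign-square : ∀ n → sign n * sign n ≡ 1ℤ
  sign-square zero    = refl
  sign-square (suc n) = trans (lemma (sign n)) (sign-square n)
    where
    lemma : ∀ a → - a * - a ≡ a * a
    lemma = solve-∀

  binom : ℕ → ℕ → ℤ
  binom n k = + (n C k)

  pascal : ∀ n k → binom (suc n) (suc k) ≡ binom n k + binom n (suc k)
  pascal n k = cong +_ (sym (nCk+nC[k+1]≡[n+1]C[k+1] n k))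

  -- At upper index `suc n` both sides equal `+ suc n * binom n j`. The subtraction is taken in ℤ,
  -- so `j > n` is covered too.
  binom-absorption : ∀ n j → + suc j * binom n (suc j) ≡ (+ n - + j) * binom n j
  binom-absorption zero zero = refl
  binom-absorption zero (suc j) = trans (ℤP.*-zeroʳ (+ suc (suc j))) (sym (ℤP.*-zeroʳ (+ 0 - + suc j)))
  binom-absorption (suc n) j = trans (step n j) (sym (step′ n j))
    where
    step : ∀ n j → + suc j * binom (suc n) (suc j) ≡ + suc n * binom n j
    step n j = begin
      + suc j * binom (suc n) (suc j)                   ≡⟨ cong (+ suc j *_) (pascal n j) ⟩
      + suc j * (binom n j + binom n (suc j))           ≡⟨ ℤP.*-distribˡ-+ (+ suc j) (binom n j) _ ⟩
      + suc j * binom n j + + suc j * binom n (suc j)   ≡⟨ +-congˡ (+ suc j * binom n j) (binom-absorption n j) ⟩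
      (1ℤ + + j) * binom n j + (+ n - + j) * binom n j  ≡⟨ lemma (+ j) (+ n) (binom n j) ⟩
      (1ℤ + + n) * binom n j                            ∎
      where
      lemma : ∀ j n c → (1ℤ + j) * c + (n - j) * c ≡ (1ℤ + n) * c
      lemma = solve-∀
    step′ : ∀ n j → (+ suc n - + j) * binom (suc n) j ≡ + suc n * binom n j
    step′ n zero = cong (_* 1ℤ) (ℤP.+-identityʳ (+ suc n))
    step′ n (suc j) = begin
      (1ℤ + + n - (1ℤ + + j)) * binom (suc n) (suc j)              ≡⟨ cong ((1ℤ + + n - (1ℤ + + j)) *_) (pascal n j) ⟩
      (1ℤ + + n - (1ℤ + + j)) * (binom n j + binom n (suc j))      ≡⟨ lemma (+ n) (+ j) (binom n j) (binom n (suc j)) ⟩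
      (+ n - + j) * binom n j + (+ n - + j) * binom n (suc j)      ≡⟨ cong (_+ (+ n - + j) * binom n (suc j)) (sym (binom-absorption n j)) ⟩
      (1ℤ + + j) * binom n (suc j) + (+ n - + j) * binom n (suc j) ≡⟨ lemma′ (+ n) (+ j) (binom n (suc j)) ⟩
      (1ℤ + + n) * binom n (suc j)                                 ∎
      where
      lemma : ∀ n j a b → (1ℤ + n - (1ℤ + j)) * (a + b) ≡ (n - j) * a + (n - j) * b
      lemma = solve-∀
      lemma′ : ∀ n j a → (1ℤ + j) * a + (n - j) * a ≡ (1ℤ + n) * a
      lemma′ = solve-∀

  altSum : ℕ → ℕ → ℤ
  altSum M zero    = 1ℤ
  altSum M (suc j) = altSum M j + sign (suc j) * binom M (suc j)

  -- This is the partial-sum formula altSum M j = (-1)^j C(M-1, j), multiplied by `M` so that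
  -- neither a division nor the index M - 1 occurs.
  altSum-closed : ∀ M j → sign (suc j) * (+ suc j * binom M (suc j)) ≡ - (+ M * altSum M j)
  altSum-closed M zero = begin
    - 1ℤ * (1ℤ * binom M 1)     ≡⟨ cong (- 1ℤ *_) (binom-absorption M 0) ⟩
    - 1ℤ * ((+ M - 0ℤ) * 1ℤ)   ≡⟨ lemma (+ M) ⟩
    - (+ M * 1ℤ)                ∎
    where
    lemma : ∀ m → - 1ℤ * ((m - 0ℤ) * 1ℤ) ≡ - (m * 1ℤ)
    lemma = solve-∀
  altSum-closed M (suc j) = begin
    - s * (+ suc (suc j) * binom M (suc (suc j)))      ≡⟨ cong (- s *_) (binom-absorption M (suc j)) ⟩
    - s * ((+ M - + suc j) * c)                         ≡⟨ lemma s (+ M) (+ suc j) c ⟩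
    s * (+ suc j * c) - + M * (s * c)                   ≡⟨ cong (_- + M * (s * c)) (altSum-closed M j) ⟩
    - (+ M * altSum M j) - + M * (s * c)                ≡⟨ lemma′ (+ M) (altSum M j) (s * c) ⟩
    - (+ M * (altSum M j + s * c))                      ∎
    where
    s c : ℤ
    s = sign (suc j)
    c = binom M (suc j)
    lemma : ∀ s m j c → - s * ((m - j) * c) ≡ s * (j * c) - m * (s * c)
    lemma = solve-∀
    lemma′ : ∀ m a b → - (m * a) - m * b ≡ - (m * (a + b))
    lemma′ = solve-∀

  -- The first-order recurrence by which `b-multiple` recognises the alternating sum.
  altSum-recurrence : ∀ M j → + suc j * altSum M (suc j) ≡ (+ suc j - + M) * altSum M j
  altSum-recurrence M j = begin
    + suc j * (altSum M j + sign (suc j) * binom M (suc j))  ≡⟨ lemma (+ suc j) (altSum M j) (sign (suc j)) _ ⟩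
    + suc j * altSum M j + sign (suc j) * (+ suc j * binom M (suc j)) ≡⟨ +-congˡ (+ suc j * altSum M j) (altSum-closed M j) ⟩
    + suc j * altSum M j + - (+ M * altSum M j)             ≡⟨ lemma′ (+ suc j) (+ M) (altSum M j) ⟩
    (+ suc j - + M) * altSum M j                            ∎
    where
    lemma : ∀ j a s c → j * (a + s * c) ≡ j * a + s * (j * c)
    lemma = solve-∀
    lemma′ : ∀ j m a → j * a + - (m * a) ≡ (j - m) * a
    lemma′ = solve-∀

  binom-> : ∀ {n k} → n ℕ.< k → binom n k ≡ 0ℤ
  binom-> n<k = cong +_ (k>n⇒nCk≡0 n<k)

  ∸-suc : ∀ {n r} → r ℕ.< n → n ℕ.∸ r ≡ suc (n ℕ.∸ suc r)
  ∸-suc {n} {r} r<n = ℕP.+-∸-assoc 1 {n} {suc r} r<n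

  -- The factor `binom n (suc r)` vanishes unless `r < n`, and for `r < n` the truncated difference
  -- `n ∸ r` is a genuine successor.
  binom-suc-*-cong : ∀ n r (f : ℕ → ℤ) (c : ℤ) → f (suc (n ℕ.∸ suc r)) ≡ c →
                     binom n (suc r) * f (n ℕ.∸ r) ≡ binom n (suc r) * c
  binom-suc-*-cong n r f c eq with r ℕP.<? n
  ... | yes r<n = cong (binom n (suc r) *_) (trans (cong f (∸-suc r<n)) eq)
  ... | no  r≮n = trans (vanish (f (n ℕ.∸ r))) (sym (vanish c))
    where
    vanish : ∀ x → binom n (suc r) * x ≡ 0ℤ
    vanish x = trans (cong (_* x) (binom-> (s≤s (ℕP.≮⇒≥ r≮n)))) (ℤP.*-zeroˡ x)

  -- Both sides count the pairs of an r-subset inside an m-subset of an n-set. The proof is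
  -- induction by Pascal's rule.
  binom-trinomial : ∀ n m r → r ℕ.≤ m → binom n m * binom m r ≡ binom n r * binom (n ℕ.∸ r) (m ℕ.∸ r)
  binom-trinomial n m zero z≤n = ℤP.*-comm (binom n m) 1ℤ
  binom-trinomial zero (suc m) (suc r) (s≤s r≤m) = refl
  binom-trinomial (suc n) (suc m) (suc r) (s≤s r≤m) = begin
    binom (suc n) (suc m) * binom (suc m) (suc r)
      ≡⟨ cong (_* binom (suc m) (suc r)) (pascal n m) ⟩
    (binom n m + binom n (suc m)) * binom (suc m) (suc r)
      ≡⟨ ℤP.*-distribʳ-+ (binom (suc m) (suc r)) (binom n m) (binom n (suc m)) ⟩
    binom n m * binom (suc m) (suc r) + binom n (suc m) * binom (suc m) (suc r)
      ≡⟨ cong₂ _+_ (cong (binom n m *_) (pascal m r)) (binom-trinomial n (suc m) (suc r) (s≤s r≤m)) ⟩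
    binom n m * (binom m r + binom m (suc r)) + y
      ≡⟨ cong (_+ y) (ℤP.*-distribˡ-+ (binom n m) (binom m r) (binom m (suc r))) ⟩
    binom n m * binom m r + binom n m * binom m (suc r) + y
      ≡⟨ cong (λ t → t + binom n m * binom m (suc r) + y) (binom-trinomial n m r r≤m) ⟩
    binom n r * z + binom n m * binom m (suc r) + y
      ≡⟨ ℤP.+-assoc (binom n r * z) _ y ⟩
    binom n r * z + (binom n m * binom m (suc r) + y)
      ≡⟨ +-congˡ (binom n r * z) rest ⟩
    binom n r * z + binom n (suc r) * z
      ≡⟨ sym (ℤP.*-distribʳ-+ z (binom n r) (binom n (suc r))) ⟩
    (binom n r + binom n (suc r)) * z
      ≡⟨ cong (_* z) (sym (pascal n r)) ⟩
    binom (suc n) (suc r) * z ∎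
    where
    y z : ℤ
    y = binom n (suc r) * binom (n ℕ.∸ suc r) (m ℕ.∸ r)
    z = binom (n ℕ.∸ r) (m ℕ.∸ r)
    rest : binom n m * binom m (suc r) + y ≡ binom n (suc r) * z
    -- The induction hypothesis for `binom m (suc r)` requires `suc r ≤ m`. Otherwise that
    -- coefficient is `0` and `m ∸ r` is `0`.
    rest with suc r ℕP.≤? m
    ... | yes r<m = begin
      binom n m * binom m (suc r) + y
        ≡⟨ cong (_+ y) (binom-trinomial n m (suc r) r<m) ⟩
      binom n (suc r) * binom (n ℕ.∸ suc r) (m ℕ.∸ suc r) + y
        ≡⟨ sym (ℤP.*-distribˡ-+ (binom n (suc r)) (binom (n ℕ.∸ suc r) (m ℕ.∸ suc r)) (binom (n ℕ.∸ suc r) (m ℕ.∸ r))) ⟩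
      binom n (suc r) * (binom (n ℕ.∸ suc r) (m ℕ.∸ suc r) + binom (n ℕ.∸ suc r) (m ℕ.∸ r))
        ≡⟨ sym (binom-suc-*-cong n r (λ t → binom t (m ℕ.∸ r)) _ step) ⟩
      binom n (suc r) * z ∎
      where
      step : binom (suc (n ℕ.∸ suc r)) (m ℕ.∸ r) ≡ binom (n ℕ.∸ suc r) (m ℕ.∸ suc r) + binom (n ℕ.∸ suc r) (m ℕ.∸ r)
      step rewrite ∸-suc r<m = pascal (n ℕ.∸ suc r) (m ℕ.∸ suc r)
    ... | no r≮m = begin
      binom n m * binom m (suc r) + y
        ≡⟨ cong (λ t → binom n m * t + y) (binom-> (ℕP.≰⇒> r≮m)) ⟩
      binom n m * 0ℤ + y
        ≡⟨ cong (_+ y) (ℤP.*-zeroʳ (binom n m)) ⟩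
      0ℤ + y
        ≡⟨ ℤP.+-identityˡ y ⟩
      y
        ≡⟨ sym (binom-suc-*-cong n r (λ t → binom t (m ℕ.∸ r)) _ step) ⟩
      binom n (suc r) * z ∎
      where
      step : binom (suc (n ℕ.∸ suc r)) (m ℕ.∸ r) ≡ binom (n ℕ.∸ suc r) (m ℕ.∸ r)
      step rewrite ℕP.m≤n⇒m∸n≡0 (ℕP.≮⇒≥ r≮m) = refl

  -- The main term in integers and its Pascal recurrences.

  -- partialT q a l = Σ_{j<l} (-1)^j q^(l-1-j) C(a,j)
  partialT : ℤ → ℕ → ℕ → ℤ
  partialT q a zero    = 0ℤ
  partialT q a (suc l) = q * partialT q a l + sign l * binom a l

  -- `partialT q a (suc l)` is the coefficient of x^l in (1 - x)^a / (1 - q x); raising `a` by one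
  -- multiplies the series by 1 - x.
  partialT-pascal : ∀ q a l → partialT q (suc a) (suc l) ≡ partialT q a (suc l) - partialT q a l
  partialT-pascal q a zero = sym (ℤP.+-identityʳ _)
  partialT-pascal q a (suc l) = begin
    q * partialT q (suc a) (suc l) + - sign l * binom (suc a) (suc l)
      ≡⟨ cong₂ (λ u v → q * u + - sign l * v) (partialT-pascal q a l) (pascal a l) ⟩
    q * (partialT q a (suc l) - partialT q a l) + - sign l * (binom a l + binom a (suc l))
      ≡⟨ lemma q (partialT q a (suc l)) (partialT q a l) (sign l) (binom a l) (binom a (suc l)) ⟩
    q * partialT q a (suc l) + - sign l * binom a (suc l) - (q * partialT q a l + sign l * binom a l) ∎
    where
    lemma : ∀ q x y s c d → q * (x - y) + - s * (c + d) ≡ q * x + - s * d - (q * y + s * c)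
    lemma = solve-∀

  -- For `m ≤ r` truncation makes all three lengths `0`, and the identity reads 0 = 0 - 0.
  partialT-pascal-∸ : ∀ q a m r →
    partialT q (suc a) (m ℕ.∸ r) ≡ partialT q a (m ℕ.∸ r) - partialT q a (m ℕ.∸ suc r)
  partialT-pascal-∸ q a m r with r ℕP.<? m
  ... | yes r<m rewrite ∸-suc r<m = partialT-pascal q a (m ℕ.∸ suc r)
  ... | no r≮m rewrite ℕP.m≤n⇒m∸n≡0 (ℕP.≮⇒≥ r≮m) | ℕP.m≤n⇒m∸n≡0 (ℕP.m≤n⇒m≤1+n (ℕP.≮⇒≥ r≮m)) = refl

  -- The value T of the statement with the power of q moved inside the sum, which makes every term
  -- an integer. The index `m` is the degree k + 1, so the length `m ∸ r` covers j = 0, ..., k - r.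
  mainTerm : ℤ → ℕ → ℕ → ℕ → ℤ
  mainTerm q n m r = binom n r * partialT q (n ℕ.∸ r) (m ℕ.∸ r)

  mainTerm-zero : ∀ q n m → mainTerm q (suc n) (suc m) 0 ≡ mainTerm q n (suc m) 0 - mainTerm q n m 0
  mainTerm-zero q n m = begin
    1ℤ * partialT q (suc n) (suc m)                        ≡⟨ cong (1ℤ *_) (partialT-pascal q n m) ⟩
    1ℤ * (partialT q n (suc m) - partialT q n m)           ≡⟨ lemma (partialT q n (suc m)) (partialT q n m) ⟩
    1ℤ * partialT q n (suc m) - 1ℤ * partialT q n m        ∎
    where
    lemma : ∀ x y → 1ℤ * (x - y) ≡ 1ℤ * x - 1ℤ * y
    lemma = solve-∀

  -- The recurrence obeyed by the polynomial counts when one element is adjoined to the list.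
  -- Pascal's rule splits off the term at `r`; `partialT-pascal-∸` splits the rest.
  mainTerm-suc : ∀ q n m r →
    mainTerm q (suc n) (suc m) (suc r) ≡ mainTerm q n (suc m) (suc r) - mainTerm q n m (suc r) + mainTerm q n m r
  mainTerm-suc q n m r = begin
    binom (suc n) (suc r) * v
      ≡⟨ cong (_* v) (pascal n r) ⟩
    (binom n r + binom n (suc r)) * v
      ≡⟨ ℤP.*-distribʳ-+ v (binom n r) (binom n (suc r)) ⟩
    binom n r * v + binom n (suc r) * v
      ≡⟨ +-congˡ (binom n r * v) (binom-suc-*-cong n r (λ t → partialT q t (m ℕ.∸ r)) (x - y) (partialT-pascal-∸ q (n ℕ.∸ suc r) m r)) ⟩
    binom n r * v + binom n (suc r) * (x - y)
      ≡⟨ lemma (binom n r) v (binom n (suc r)) x y ⟩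
    binom n (suc r) * x - binom n (suc r) * y + binom n r * v ∎
    where
    v x y : ℤ
    v = partialT q (n ℕ.∸ r) (m ℕ.∸ r)
    x = partialT q (n ℕ.∸ suc r) (m ℕ.∸ r)
    y = partialT q (n ℕ.∸ suc r) (m ℕ.∸ suc r)
    lemma : ∀ a v b x y → a * v + b * (x - y) ≡ b * x - b * y + a * v
    lemma = solve-∀

  -- Solving the recurrence of period p.

  module PeriodicRecurrence
    (p′ n : ℕ) (b : ℕ → ℤ) (a : ℕ → ℕ → ℤ)
    (b-zero  : b 0 ≡ 1ℤ)
    (a-zero  : ∀ i → a i 0 ≡ 0ℤ)
    (a-step  : ∀ i m → i ℕ.< p′ → a i (suc m) ≡ b m + a (suc i) m)
    (a-last  : ∀ m → a p′ (suc m) ≡ (+ m - + n) * b m)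
    (a-first : ∀ m → a 0 m ≡ + m * b m)
    where

    private
      p : ℕ
      p = suc p′

    -- Going back along `a-step` raises `i` and lowers `m`, so `i + s` stays constant. While
    -- `i + s < p` the path reaches the start of the block; otherwise it meets `a-last` inside the
    -- block, which turns the factor m into m - (n + 1). Every value is a multiple of `b (j * p)`.
    record Block (j s : ℕ) : Set where
      field
        b-const : b (s ℕ.+ j ℕ.* p) ≡ b (j ℕ.* p)
        a-low   : ∀ i → i ℕ.+ s ℕ.< p → a i (s ℕ.+ j ℕ.* p) ≡ + (s ℕ.+ j ℕ.* p) * b (j ℕ.* p)
        a-high  : ∀ i → i ℕ.< p → p ℕ.≤ i ℕ.+ s →
                  a i (s ℕ.+ j ℕ.* p) ≡ (+ (s ℕ.+ j ℕ.* p) - + suc n) * b (j ℕ.* p)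
    open Block

    block-suc : ∀ j s → suc s ℕ.< p → Block j s → Block j (suc s)
    block-suc j s s+1<p blk = record { b-const = const ; a-low = low ; a-high = high }
      where
      m : ℕ
      m = s ℕ.+ j ℕ.* p
      β : ℤ
      β = b (j ℕ.* p)
      low : ∀ i → i ℕ.+ suc s ℕ.< p → a i (suc m) ≡ + suc m * β
      low i h = begin
        a i (suc m)          ≡⟨ a-step i m (ℕP.≤-pred (ℕP.≤-trans (s≤s (s≤s (ℕP.m≤m+n i s))) h′)) ⟩
        b m + a (suc i) m    ≡⟨ cong₂ _+_ (b-const blk) (a-low blk (suc i) h′) ⟩
        β + + m * β          ≡⟨ lemma β (+ m) ⟩
        (1ℤ + + m) * β       ∎
        where
        h′ : suc i ℕ.+ s ℕ.< p
        h′ = subst (ℕ._< p) (ℕP.+-suc i s) h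
        lemma : ∀ β m → β + m * β ≡ (1ℤ + m) * β
        lemma = solve-∀
      high : ∀ i → i ℕ.< p → p ℕ.≤ i ℕ.+ suc s → a i (suc m) ≡ (+ suc m - + suc n) * β
      high i i<p h with i ℕP.<? p′
      ... | yes i<p′ = begin
        a i (suc m)                          ≡⟨ a-step i m i<p′ ⟩
        b m + a (suc i) m                    ≡⟨ cong₂ _+_ (b-const blk) (a-high blk (suc i) (s≤s i<p′) (subst (p ℕ.≤_) (ℕP.+-suc i s) h)) ⟩
        β + (+ m - + suc n) * β              ≡⟨ lemma β (+ m) (+ suc n) ⟩
        (1ℤ + + m - + suc n) * β             ∎
        where
        lemma : ∀ β m n → β + (m - n) * β ≡ (1ℤ + m - n) * β
        lemma = solve-∀
      ... | no i≮p′ with ℕP.≤-antisym (ℕP.≤-pred i<p) (ℕP.≮⇒≥ i≮p′)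
      ... | refl = begin
        a p′ (suc m)                         ≡⟨ a-last m ⟩
        (+ m - + n) * b m                    ≡⟨ cong ((+ m - + n) *_) (b-const blk) ⟩
        (+ m - + n) * β                      ≡⟨ lemma β (+ m) (+ n) ⟩
        (1ℤ + + m - (1ℤ + + n)) * β          ∎
        where
        lemma : ∀ β m n → (m - n) * β ≡ (1ℤ + m - (1ℤ + n)) * β
        lemma = solve-∀
      const : b (suc m) ≡ β
      -- Since `suc s < p`, index `0` is still in the low range; comparison with `a-first` leaves a
      -- nonzero factor to cancel.
      const = ℤP.*-cancelˡ-≡ (+ suc m) (b (suc m)) β (trans (sym (a-first (suc m))) (low 0 s+1<p))

    block-range : ∀ j → Block j 0 → ∀ s → s ℕ.< p → Block j s
    block-range j b₀ zero    _   = b₀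
    block-range j b₀ (suc s) s<p = block-suc j s s<p (block-range j b₀ s (ℕP.<-trans (ℕP.n<1+n s) s<p))

    -- At the last position of a block every index `suc i < p` lies in the high range, and `i = p′`
    -- is handled by `a-last`. The value therefore no longer depends on `i`.
    wrap-a : ∀ j → Block j p′ → ∀ i → i ℕ.< p →
             a i (suc j ℕ.* p) ≡ (+ (suc j ℕ.* p) - + suc n) * b (j ℕ.* p)
    wrap-a j blk i i<p with i ℕP.<? p′
    ... | yes i<p′ = begin
      a i (suc m)                          ≡⟨ a-step i m i<p′ ⟩
      b m + a (suc i) m                    ≡⟨ cong₂ _+_ (b-const blk) (a-high blk (suc i) (s≤s i<p′) (s≤s (ℕP.m≤n+m p′ i))) ⟩
      β + (+ m - + suc n) * β              ≡⟨ lemma β (+ m) (+ suc n) ⟩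
      (1ℤ + + m - + suc n) * β             ∎
      where
      m : ℕ
      m = p′ ℕ.+ j ℕ.* p
      β : ℤ
      β = b (j ℕ.* p)
      lemma : ∀ β m n → β + (m - n) * β ≡ (1ℤ + m - n) * β
      lemma = solve-∀
    ... | no i≮p′ with ℕP.≤-antisym (ℕP.≤-pred i<p) (ℕP.≮⇒≥ i≮p′)
    ... | refl = begin
      a p′ (suc m)                         ≡⟨ a-last m ⟩
      (+ m - + n) * b m                    ≡⟨ cong ((+ m - + n) *_) (b-const blk) ⟩
      (+ m - + n) * β                      ≡⟨ lemma β (+ m) (+ n) ⟩
      (1ℤ + + m - (1ℤ + + n)) * β          ∎
      where
      m : ℕ
      m = p′ ℕ.+ j ℕ.* p
      β : ℤ
      β = b (j ℕ.* p)
      lemma : ∀ β m n → (m - n) * β ≡ (1ℤ + m - (1ℤ + n)) * β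
      lemma = solve-∀

    wrap-b : ∀ j → Block j p′ → + (suc j ℕ.* p) * b (suc j ℕ.* p) ≡ (+ (suc j ℕ.* p) - + suc n) * b (j ℕ.* p)
    wrap-b j blk = trans (sym (a-first (suc j ℕ.* p))) (wrap-a j blk 0 (s≤s z≤n))

    -- `wrap-b`, the case `i = 0` of `wrap-a` read through `a-first`, turns the common value into
    -- the low value of the new block. The high range is empty at `s = 0`.
    block-start : ∀ j → Block j 0
    block-start zero = record
      { b-const = refl
      ; a-low   = λ i _ → trans (a-zero i) (sym (ℤP.*-zeroˡ (b 0)))
      ; a-high  = λ i i<p p≤i → contradiction (ℕP.<-≤-trans i<p (subst (p ℕ.≤_) (ℕP.+-identityʳ i) p≤i)) (ℕP.<-irrefl refl)
      }
    block-start (suc j) = record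
      { b-const = refl
      ; a-low   = λ i i<p → trans (wrap-a j last i (subst (ℕ._< p) (ℕP.+-identityʳ i) i<p)) (sym (wrap-b j last))
      ; a-high  = λ i i<p p≤i → contradiction (ℕP.<-≤-trans i<p (subst (p ℕ.≤_) (ℕP.+-identityʳ i) p≤i)) (ℕP.<-irrefl refl)
      }
      where
      last : Block j p′
      last = block-range j (block-start j) p′ (ℕP.n<1+n p′)

    b-recurrence : ∀ j → + (suc j ℕ.* p) * b (suc j ℕ.* p) ≡ (+ (suc j ℕ.* p) - + suc n) * b (j ℕ.* p)
    b-recurrence j = wrap-b j (block-range j (block-start j) p′ (ℕP.n<1+n p′))

    -- Since b 0 = 1, the case `j = 0` of `b-recurrence` reads p b(p) = p - (n + 1) in ℤ.
    period∣ : p ∣ suc n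
    period∣ = ℤ∣.∣⇒∣ᵤ (ℤ∣.divides (1ℤ - b (1 ℕ.* p)) eq)
      where
      eq : + suc n ≡ (1ℤ - b (1 ℕ.* p)) * + p
      eq = begin
        + suc n                                                    ≡⟨ lemma (+ suc n) (+ p) ⟩
        + p - (+ p - + suc n) * 1ℤ                                 ≡⟨ cong (λ t → + p - (+ p - + suc n) * t) (sym b-zero) ⟩
        + p - (+ p - + suc n) * b 0                                ≡⟨ cong (λ t → + p - (+ t - + suc n) * b 0) (sym (ℕP.*-identityˡ p)) ⟩
        + p - (+ (1 ℕ.* p) - + suc n) * b 0                        ≡⟨ cong (λ t → + p - t) (sym (b-recurrence 0)) ⟩
        + p - + (1 ℕ.* p) * b (1 ℕ.* p)                            ≡⟨ cong (λ t → + p - + t * b (1 ℕ.* p)) (ℕP.*-identityˡ p) ⟩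
        + p - + p * b (1 ℕ.* p)                                    ≡⟨ lemma′ (+ p) (b (1 ℕ.* p)) ⟩
        (1ℤ - b (1 ℕ.* p)) * + p                                   ∎
        where
        lemma : ∀ n p → n ≡ p - (p - n) * 1ℤ
        lemma = solve-∀
        lemma′ : ∀ p b → p - p * b ≡ (1ℤ - b) * p
        lemma′ = solve-∀

    -- With n + 1 = M p a factor p cancels from `b-recurrence`, which leaves `altSum-recurrence`;
    -- its leading coefficient j + 1 is nonzero.
    b-multiple : ∀ M → suc n ≡ M ℕ.* p → ∀ j → b (j ℕ.* p) ≡ altSum M j
    b-multiple M eq zero    = b-zero
    b-multiple M eq (suc j) =
      ℤP.*-cancelˡ-≡ (+ suc j) (b (suc j ℕ.* p)) (altSum M (suc j))
        (ℤP.*-cancelˡ-≡ (+ p) (+ suc j * b (suc j ℕ.* p)) (+ suc j * altSum M (suc j)) (begin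
          + p * (+ suc j * b (suc j ℕ.* p))              ≡⟨ lemma (+ p) (+ suc j) (b (suc j ℕ.* p)) ⟩
          + suc j * + p * b (suc j ℕ.* p)                ≡⟨ cong (_* b (suc j ℕ.* p)) (sym (ℤP.pos-* (suc j) p)) ⟩
          + (suc j ℕ.* p) * b (suc j ℕ.* p)              ≡⟨ b-recurrence j ⟩
          (+ (suc j ℕ.* p) - + suc n) * b (j ℕ.* p)      ≡⟨ cong (λ t → (+ (suc j ℕ.* p) - + t) * b (j ℕ.* p)) eq ⟩
          (+ (suc j ℕ.* p) - + (M ℕ.* p)) * b (j ℕ.* p)  ≡⟨ cong₂ (λ u v → (u - v) * b (j ℕ.* p)) (ℤP.pos-* (suc j) p) (ℤP.pos-* M p) ⟩
          (+ suc j * + p - + M * + p) * b (j ℕ.* p)      ≡⟨ cong ((+ suc j * + p - + M * + p) *_) (b-multiple M eq j) ⟩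
          (+ suc j * + p - + M * + p) * altSum M j       ≡⟨ lemma′ (+ suc j) (+ p) (+ M) (altSum M j) ⟩
          + p * ((+ suc j - + M) * altSum M j)           ≡⟨ cong (+ p *_) (sym (altSum-recurrence M j)) ⟩
          + p * (+ suc j * altSum M (suc j))             ∎))
      where
      lemma : ∀ p j b → p * (j * b) ≡ j * p * b
      lemma = solve-∀
      lemma′ : ∀ j p m x → (j * p - m * p) * x ≡ p * ((j - m) * x)
      lemma′ = solve-∀

    b-closed : ∀ m → b m ≡ altSum (suc n ℕ./ p) (m ℕ./ p)
    b-closed m = begin
      b m                                          ≡⟨ cong b (ℕD.m≡m%n+[m/n]*n m p) ⟩
      b (m ℕ.% p ℕ.+ m ℕ./ p ℕ.* p)                ≡⟨ b-const (block-range (m ℕ./ p) (block-start (m ℕ./ p)) (m ℕ.% p) (ℕD.m%n<n m p)) ⟩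
      b (m ℕ./ p ℕ.* p)                            ≡⟨ b-multiple (suc n ℕ./ p) (sym (ℕD.m/n*n≡m period∣)) (m ℕ./ p) ⟩
      altSum (suc n ℕ./ p) (m ℕ./ p)               ∎

-- Arithmetic in the field.

module FieldTheory (F : FiniteField) where
  open import Data.Integer using (_+_; _*_; -_; _-_)
  open FiniteField F public using (Carrier; 0#; 1#; natElt; isCommutativeRing; enum) renaming (_+_ to _⊕_; _*_ to _⊗_; -_ to ⊖_)

  commutativeRing : CommutativeRing _ _
  commutativeRing = record { isCommutativeRing = isCommutativeRing }

  module R = CommutativeRing commutativeRing
  open AbelianGroupProperties R.+-abelianGroup
  open SemiringMult R.semiring using (×-assocˡ; ×-assoc-*) renaming (_×_ to _·_)

  infixl 6 _⊝_
  _⊝_ : Carrier → Carrier → Carrier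
  x ⊝ y = x ⊕ ⊖ y

  -- Abstract because the unfolded test would no longer match the one inside filter under with.
  infix 4 _≟_
  abstract
    _≟_ : DecidableEquality Carrier
    _≟_ = via-injection (↔⇒↣ enum) FinP._≟_

  ⊝-swap : ∀ x y z → x ⊝ y ⊝ z ≡ x ⊝ z ⊝ y
  ⊝-swap x y z = begin
    x ⊝ y ⊝ z          ≡⟨ R.+-assoc x (⊖ y) (⊖ z) ⟩
    x ⊕ (⊖ y ⊕ ⊖ z)    ≡⟨ cong (x ⊕_) (R.+-comm (⊖ y) (⊖ z)) ⟩
    x ⊕ (⊖ z ⊕ ⊖ y)    ≡⟨ sym (R.+-assoc x (⊖ z) (⊖ y)) ⟩
    x ⊝ z ⊝ y          ∎

  ⊝-⊕ : ∀ x y z → x ⊝ y ⊝ z ≡ x ⊝ (z ⊕ y)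
  ⊝-⊕ x y z = begin
    x ⊝ y ⊝ z          ≡⟨ R.+-assoc x (⊖ y) (⊖ z) ⟩
    x ⊕ (⊖ y ⊕ ⊖ z)    ≡⟨ cong (x ⊕_) (⁻¹-∙-comm y z) ⟩
    x ⊝ (y ⊕ z)        ≡⟨ cong (x ⊝_) (R.+-comm y z) ⟩
    x ⊝ (z ⊕ y)        ∎

  ⊝-identityʳ : ∀ x → x ⊝ 0# ≡ x
  ⊝-identityʳ x = trans (cong (x ⊕_) ε⁻¹≈ε) (R.+-identityʳ x)

  ⊝-⊝ : ∀ x y → x ⊝ (x ⊝ y) ≡ y
  ⊝-⊝ x y = begin
    x ⊝ (x ⊝ y)   ≡⟨ cong (x ⊕_) (⁻¹-anti-homo‿- x y) ⟩
    x ⊕ (y ⊝ x)   ≡⟨ sym (R.+-assoc x y (⊖ x)) ⟩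
    x ⊕ y ⊝ x     ≡⟨ xyx⁻¹≈y x y ⟩
    y             ∎

  ·-zero : ∀ n → n · 0# ≡ 0#
  ·-zero zero    = refl
  ·-zero (suc n) = trans (R.+-identityˡ (n · 0#)) (·-zero n)

  ·-⊖ : ∀ n x → n · (⊖ x) ≡ ⊖ (n · x)
  ·-⊖ zero    x = sym ε⁻¹≈ε
  ·-⊖ (suc n) x = trans (cong (⊖ x ⊕_) (·-⊖ n x)) (⁻¹-∙-comm x (n · x))

  natElt≡· : ∀ n → natElt n ≡ n · 1#
  natElt≡· zero    = refl
  natElt≡· (suc n) = cong (1# ⊕_) (natElt≡· n)

  characteristic-kills : ∀ {p} → natElt p ≡ 0# → ∀ x → p · x ≡ 0#
  characteristic-kills {p} char x = begin
    p · x           ≡⟨ cong (p ·_) (sym (R.*-identityˡ x)) ⟩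
    p · (1# ⊗ x)    ≡⟨ sym (×-assoc-* p 1# x) ⟩
    (p · 1#) ⊗ x    ≡⟨ cong (_⊗ x) (trans (sym (natElt≡· p)) char) ⟩
    0# ⊗ x          ≡⟨ R.zeroˡ x ⟩
    0#              ∎

  -- Counting subsets by their sum.

  subsetSums : List Carrier → ℕ → Carrier → ℤ
  subsetSums L       zero    γ = indicator (γ ≟ 0#)
  subsetSums []      (suc m) γ = 0ℤ
  subsetSums (d ∷ L) (suc m) γ = subsetSums L (suc m) γ + subsetSums L m (γ ⊝ d)

  -- If x occurs once in L, this is the number of m-subsets of L that contain x and have sum γ:
  -- adjoin x to an (m-1)-subset, and subtract the cases in which x was already present.
  subsetSumsWith : List Carrier → Carrier → ℕ → Carrier → ℤ
  subsetSumsWith L x zero    γ = 0ℤ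
  subsetSumsWith L x (suc m) γ = subsetSums L m (γ ⊝ x) - subsetSumsWith L x m (γ ⊝ x)

  -- `subsetSumsWith` is an alternating combination of translates of `subsetSums L`, so it inherits
  -- the recursion of `subsetSums` in the list.
  subsetSumsWith-∷ : ∀ d L x m γ →
    subsetSumsWith (d ∷ L) x (suc m) γ ≡ subsetSumsWith L x (suc m) γ + subsetSumsWith L x m (γ ⊝ d)
  subsetSumsWith-∷ d L x zero    γ = sym (ℤP.+-identityʳ _)
  subsetSumsWith-∷ d L x (suc m) γ = begin
    s + subsetSums L m (γ ⊝ x ⊝ d) - subsetSumsWith (d ∷ L) x (suc m) (γ ⊝ x)
      ≡⟨ cong (λ t → s + subsetSums L m (γ ⊝ x ⊝ d) - t) (subsetSumsWith-∷ d L x m (γ ⊝ x)) ⟩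
    s + subsetSums L m (γ ⊝ x ⊝ d) - (w + subsetSumsWith L x m (γ ⊝ x ⊝ d))
      ≡⟨ cong (λ δ → s + subsetSums L m δ - (w + subsetSumsWith L x m δ)) (⊝-swap γ x d) ⟩
    s + subsetSums L m (γ ⊝ d ⊝ x) - (w + subsetSumsWith L x m (γ ⊝ d ⊝ x))
      ≡⟨ lemma s w _ _ ⟩
    s - w + (subsetSums L m (γ ⊝ d ⊝ x) - subsetSumsWith L x m (γ ⊝ d ⊝ x)) ∎
    where
    s w : ℤ
    s = subsetSums L (suc m) (γ ⊝ x)
    w = subsetSumsWith L x (suc m) (γ ⊝ x)
    lemma : ∀ s w a b → s + a - (w + b) ≡ s - w + (a - b)
    lemma = solve-∀

  -- The subtracted term cancels exactly the subsets that already use the head `d`, which leaves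
  -- those drawn from `L`.
  subsetSumsWith-head : ∀ d L m γ → subsetSumsWith (d ∷ L) d (suc m) γ ≡ subsetSums L m (γ ⊝ d)
  subsetSumsWith-head d L zero    γ = ℤP.+-identityʳ _
  subsetSumsWith-head d L (suc m) γ = begin
    s + t - subsetSumsWith (d ∷ L) d (suc m) (γ ⊝ d)   ≡⟨ cong (λ u → s + t - u) (subsetSumsWith-head d L m (γ ⊝ d)) ⟩
    s + t - t                                          ≡⟨ lemma s t ⟩
    s                                                  ∎
    where
    s t : ℤ
    s = subsetSums L (suc m) (γ ⊝ d)
    t = subsetSums L m (γ ⊝ d ⊝ d)
    lemma : ∀ s t → s + t - t ≡ s
    lemma = solve-∀

  -- Double counting: an m-subset contributes once for each of its m elements.
  subsetSumsWith-total : ∀ L m γ → sumOver L (λ x → subsetSumsWith L x m γ) ≡ + m * subsetSums L m γ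
  subsetSumsWith-total L zero γ = trans (sumOver-zero L (λ _ _ → refl)) (sym (ℤP.*-zeroˡ (subsetSums L 0 γ)))
  subsetSumsWith-total [] (suc m) γ = sym (ℤP.*-zeroʳ (+ suc m))
  subsetSumsWith-total (d ∷ L) (suc m) γ = begin
    subsetSumsWith (d ∷ L) d (suc m) γ + sumOver L (λ x → subsetSumsWith (d ∷ L) x (suc m) γ)
      ≡⟨ cong₂ _+_ (subsetSumsWith-head d L m γ) (sumOver-cong L (λ x _ → subsetSumsWith-∷ d L x m γ)) ⟩
    t + sumOver L (λ x → subsetSumsWith L x (suc m) γ + subsetSumsWith L x m (γ ⊝ d))
      ≡⟨ +-congˡ t (sumOver-+ L _ _) ⟩
    t + (sumOver L (λ x → subsetSumsWith L x (suc m) γ) + sumOver L (λ x → subsetSumsWith L x m (γ ⊝ d)))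
      ≡⟨ +-congˡ t (cong₂ _+_ (subsetSumsWith-total L (suc m) γ) (subsetSumsWith-total L m (γ ⊝ d))) ⟩
    t + ((1ℤ + + m) * s + + m * t)
      ≡⟨ lemma (+ m) s t ⟩
    (1ℤ + + m) * (s + t) ∎
    where
    s t : ℤ
    s = subsetSums L (suc m) γ
    t = subsetSums L m (γ ⊝ d)
    lemma : ∀ m s t → t + ((1ℤ + m) * s + m * t) ≡ (1ℤ + m) * (s + t)
    lemma = solve-∀

  -- Subset sums inside the subgroup.

  module Subgroup (D : List Carrier) (uniqueD : Unique D) (0∉D : 0# ∉ D) (subgroup : D∪0IsAddSubgroup F D) where

    G : List Carrier
    G = 0# ∷ D

    private
      toG : ∀ {x} → InD∪0 F D x → x ∈ G
      toG (inj₁ eq) = here eq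
      toG (inj₂ x∈) = there x∈

      fromG : ∀ {x} → x ∈ G → InD∪0 F D x
      fromG (here eq)  = inj₁ eq
      fromG (there x∈) = inj₂ x∈

    uniqueG : Unique G
    uniqueG = tabulate (λ x∈ 0≡x → 0∉D (subst (_∈ D) (sym 0≡x) x∈)) ∷ uniqueD

    ⊕-closed : ∀ {x y} → x ∈ G → y ∈ G → x ⊕ y ∈ G
    ⊕-closed x∈ y∈ = toG (proj₁ subgroup _ _ (fromG x∈) (fromG y∈))

    ⊖-closed : ∀ {x} → x ∈ G → ⊖ x ∈ G
    ⊖-closed x∈ = toG (proj₂ subgroup _ (fromG x∈))

    ⊝-closed : ∀ {x y} → x ∈ G → y ∈ G → x ⊝ y ∈ G
    ⊝-closed x∈ y∈ = ⊕-closed x∈ (⊖-closed y∈)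

    ·-closed : ∀ n {x} → x ∈ G → n · x ∈ G
    ·-closed zero    x∈ = here refl
    ·-closed (suc n) x∈ = ⊕-closed x∈ (·-closed n x∈)

    sumOver-translate : ∀ {d} → d ∈ G → (f : Carrier → ℤ) → sumOver G (λ g → f (g ⊝ d)) ≡ sumOver G f
    sumOver-translate {d} d∈ f =
      sumOver-bijection uniqueG uniqueG (_⊝ d) (λ {x} {y} → ∙-cancelʳ (⊖ d) x y) (λ x∈ → ⊝-closed x∈ d∈)
        (λ {y} y∈ → y ⊕ d , ⊕-closed y∈ d∈ , sym (//-rightDividesʳ d y)) f

    -- If γ - d were in `G` for some `d` in `G`, then so would be γ; hence both branches of the
    -- recursion stay outside `G`. This settles case (b).
    subsetSums-outside : ∀ L → (∀ {x} → x ∈ L → x ∈ G) → ∀ m {γ} → γ ∉ G → subsetSums L m γ ≡ 0ℤ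
    subsetSums-outside L       L⊆G zero    {γ} γ∉ = indicator-no (γ ≟ 0#) (λ eq → γ∉ (here eq))
    subsetSums-outside []      L⊆G (suc m) γ∉ = refl
    subsetSums-outside (d ∷ L) L⊆G (suc m) {γ} γ∉ =
      cong₂ _+_ (subsetSums-outside L (λ x∈ → L⊆G (there x∈)) (suc m) γ∉)
                (subsetSums-outside L (λ x∈ → L⊆G (there x∈)) m
                  (λ γ-d∈ → γ∉ (subst (_∈ G) (//-rightDividesˡ d γ) (⊕-closed γ-d∈ (L⊆G (here refl))))))

    -- Every m-subset has exactly one sum, and that sum lies in `G`. In the induction the translate
    -- by `d` only permutes the summands.
    subsetSums-total : ∀ L → (∀ {x} → x ∈ L → x ∈ G) → ∀ m → sumOver G (subsetSums L m) ≡ binom (length L) m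
    subsetSums-total L L⊆G zero =
      cong₂ _+_ (indicator-yes (0# ≟ 0#) refl)
        (sumOver-zero D (λ x x∈ → indicator-no (x ≟ 0#) (λ eq → 0∉D (subst (_∈ D) eq x∈))))
    subsetSums-total [] L⊆G (suc m) = sumOver-zero G (λ _ _ → refl)
    subsetSums-total (d ∷ L) L⊆G (suc m) = begin
      sumOver G (λ γ → subsetSums L (suc m) γ + subsetSums L m (γ ⊝ d))
        ≡⟨ sumOver-+ G (subsetSums L (suc m)) (λ γ → subsetSums L m (γ ⊝ d)) ⟩
      sumOver G (subsetSums L (suc m)) + sumOver G (λ γ → subsetSums L m (γ ⊝ d))
        ≡⟨ cong₂ _+_ (subsetSums-total L L⊆G′ (suc m))
             (trans (sumOver-translate (L⊆G (here refl)) (subsetSums L m)) (subsetSums-total L L⊆G′ m)) ⟩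
      binom (length L) (suc m) + binom (length L) m
        ≡⟨ ℤP.+-comm (binom (length L) (suc m)) (binom (length L) m) ⟩
      binom (length L) m + binom (length L) (suc m)
        ≡⟨ sym (pascal (length L) m) ⟩
      binom (suc (length L)) (suc m) ∎
      where
      L⊆G′ : ∀ {x} → x ∈ L → x ∈ G
      L⊆G′ x∈ = L⊆G (there x∈)

    -- Using the characteristic: scaled sums and the closed recurrence.

    module Characteristic (p′ : ℕ) (prime-p : Prime (suc p′)) (char : natElt (suc p′) ≡ 0#) where
      p n : ℕ
      p = suc p′
      n = length D

      p·-zero : ∀ x → p · x ≡ 0#
      p·-zero = characteristic-kills {p} char

      multiple-of-p : ∀ t x → (t ℕ.* p) · x ≡ 0#
      multiple-of-p t x = trans (sym (×-assocˡ x t p)) (trans (cong (t ·_) (p·-zero x)) (·-zero t))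

      record Quotient (i : ℕ) : Set where
        field
          quotient : Carrier → Carrier
          quotient-· : ∀ x → quotient (i · x) ≡ x
          ·-quotient : ∀ x → i · quotient x ≡ x
          quotient-closed : ∀ {x} → x ∈ G → quotient x ∈ G

      -- Multiples of `p` act as zero, so a Bézout identity makes `u` (from 1 + t p = u i) or its
      -- negative (from 1 + u i = t p) an inverse of `i`. Being multiples up to sign, the quotients
      -- stay in `G`.
      bézout-quotient : ∀ i → Bézout.Identity 1 p i → Quotient i
      bézout-quotient i (Bézout.-+ t u eq) = record
        { quotient = u ·_
        ; quotient-· = λ x → trans (×-assocˡ x u i) (unit x)
        ; ·-quotient = λ x → trans (×-assocˡ x i u) (trans (cong (_· x) (ℕP.*-comm i u)) (unit x))
        ; quotient-closed = ·-closed u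
        }
        where
        unit : ∀ x → (u ℕ.* i) · x ≡ x
        unit x = begin
          (u ℕ.* i) · x        ≡⟨ cong (_· x) (sym eq) ⟩
          x ⊕ (t ℕ.* p) · x    ≡⟨ cong (x ⊕_) (multiple-of-p t x) ⟩
          x ⊕ 0#               ≡⟨ R.+-identityʳ x ⟩
          x                    ∎
      bézout-quotient i (Bézout.+- t u eq) = record
        { quotient = λ x → ⊖ (u · x)
        ; quotient-· = λ x → trans (cong ⊖_ (×-assocˡ x u i)) (unit x)
        ; ·-quotient = λ x → trans (·-⊖ i (u · x)) (trans (cong ⊖_ (trans (×-assocˡ x i u) (cong (_· x) (ℕP.*-comm i u)))) (unit x))
        ; quotient-closed = λ x∈ → ⊖-closed (·-closed u x∈)
        }
        where
        unit : ∀ x → ⊖ ((u ℕ.* i) · x) ≡ x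
        unit x = sym (inverseˡ-unique x ((u ℕ.* i) · x) (trans (cong (_· x) eq) (multiple-of-p t x)))

      -- As `p` is prime, `0 < suc i < p` makes division by `suc i` possible within `G`; the
      -- preimage of y is (γ - y) divided by `suc i`.
      sumOver-scale : ∀ {i γ} → suc i ℕ.< p → γ ∈ G → (f : Carrier → ℤ) →
                      sumOver G (λ g → f (γ ⊝ suc i · g)) ≡ sumOver G f
      sumOver-scale {i} {γ} i<p γ∈ f =
        sumOver-bijection uniqueG uniqueG (λ g → γ ⊝ suc i · g) injective
          (λ x∈ → ⊝-closed γ∈ (·-closed (suc i) x∈))
          (λ {y} y∈ → quotient (γ ⊝ y) , quotient-closed (⊝-closed γ∈ y∈) ,
                      sym (trans (cong (γ ⊝_) (·-quotient (γ ⊝ y))) (⊝-⊝ γ y))) f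
        where
        open Quotient (bézout-quotient (suc i) (coprime-Bézout (prime⇒coprime prime-p i<p)))
        injective : ∀ {x y} → γ ⊝ suc i · x ≡ γ ⊝ suc i · y → x ≡ y
        injective {x} {y} eq = begin
          x                        ≡⟨ sym (quotient-· x) ⟩
          quotient (suc i · x)     ≡⟨ cong quotient (⁻¹-injective (∙-cancelˡ γ _ _ eq)) ⟩
          quotient (suc i · y)     ≡⟨ quotient-· y ⟩
          y                        ∎

      s : ℕ → Carrier → ℤ
      s = subsetSums D

      A : ℕ → ℕ → Carrier → ℤ
      A i m γ = sumOver D (λ d → subsetSumsWith D d m (γ ⊝ i · d))

      A-zero : ∀ i γ → A i 0 γ ≡ 0ℤ
      A-zero i γ = sumOver-zero D (λ _ _ → refl)

      A-first : ∀ m γ → A 0 m γ ≡ + m * s m γ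
      A-first m γ = trans
        (sumOver-cong D (λ d _ → cong (subsetSumsWith D d m) (⊝-identityʳ γ)))
        (subsetSumsWith-total D m γ)

      A-period : ∀ m γ → A p m γ ≡ A 0 m γ
      A-period m γ = sumOver-cong D (λ d _ → cong (λ t → subsetSumsWith D d m (γ ⊝ t)) (p·-zero d))

      -- Unfolding `subsetSumsWith` once removes one more copy of `d` from the target, which raises
      -- the index `i`.
      A-suc : ∀ i m γ → A i (suc m) γ ≡ sumOver D (λ d → s m (γ ⊝ suc i · d)) - A (suc i) m γ
      A-suc i m γ = trans
        (sumOver-cong D (λ d _ → cong (λ δ → s m δ - subsetSumsWith D d m δ) (⊝-⊕ γ (i · d) d)))
        (sumOver-minus D (λ d → s m (γ ⊝ suc i · d)) (λ d → subsetSumsWith D d m (γ ⊝ suc i · d)))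

      sum-scaled : ∀ {i γ} m → suc i ℕ.< p → γ ∈ G → sumOver D (λ d → s m (γ ⊝ suc i · d)) ≡ binom n m - s m γ
      sum-scaled {i} {γ} m i<p γ∈ = begin
        x                                    ≡⟨ lemma (s m γ) x ⟩
        -- The summand `s m γ` is the term at `0#` that completes the sum over `D` to one over `G`.
        s m γ + x - s m γ                    ≡⟨ cong (λ t → s m t + x - s m γ) (sym (trans (cong (γ ⊝_) (·-zero (suc i))) (⊝-identityʳ γ))) ⟩
        s m (γ ⊝ suc i · 0#) + x - s m γ     ≡⟨ cong (_- s m γ) (sumOver-scale i<p γ∈ (s m)) ⟩
        sumOver G (s m) - s m γ              ≡⟨ cong (_- s m γ) (subsetSums-total D there m) ⟩
        binom n m - s m γ                    ∎
        where
        x : ℤ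
        x = sumOver D (λ d → s m (γ ⊝ suc i · d))
        lemma : ∀ a x → x ≡ a + x - a
        lemma = solve-∀

      sum-killed : ∀ m γ → sumOver D (λ d → s m (γ ⊝ p · d)) ≡ + n * s m γ
      sum-killed m γ = trans
        (sumOver-cong D (λ d _ → cong (s m) (trans (cong (γ ⊝_) (p·-zero d)) (⊝-identityʳ γ))))
        (sumOver-const D (s m γ))

      altSubsetSum : ℕ → ℤ
      altSubsetSum m = altSum (suc n ℕ./ p) (m ℕ./ p)

      module _ {γ : Carrier} (γ∈D : γ ∈ D) where
        private
          -- The factor `sign m` turns the subtraction in `A-suc` into the addition required by
          -- `a-step`; taking the difference between `0#` and `γ` removes `binom n m`.
          b : ℕ → ℤ
          b m = sign m * (s m 0# - s m γ)

          a : ℕ → ℕ → ℤ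
          a i m = sign m * (A i m 0# - A i m γ)

          b-zero : b 0 ≡ 1ℤ
          b-zero = cong (1ℤ *_) (cong₂ _-_ (indicator-yes (0# ≟ 0#) refl)
                     (indicator-no (γ ≟ 0#) (λ eq → 0∉D (subst (_∈ D) eq γ∈D))))

          a-zero : ∀ i → a i 0 ≡ 0ℤ
          a-zero i = cong (1ℤ *_) (cong₂ _-_ (A-zero i 0#) (A-zero i γ))

          a-first : ∀ m → a 0 m ≡ + m * b m
          a-first m = trans (cong (sign m *_) (cong₂ _-_ (A-first m 0#) (A-first m γ)))
                            (lemma (sign m) (+ m) (s m 0#) (s m γ))
            where
            lemma : ∀ g m x y → g * (m * x - m * y) ≡ m * (g * (x - y))
            lemma = solve-∀

          a-step : ∀ i m → i ℕ.< p′ → a i (suc m) ≡ b m + a (suc i) m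
          a-step i m i<p′ = trans
            (cong (- sign m *_) (cong₂ _-_ (expand 0# (here refl)) (expand γ (there γ∈D))))
            (lemma (sign m) (binom n m) (s m 0#) (s m γ) (A (suc i) m 0#) (A (suc i) m γ))
            where
            expand : ∀ δ → δ ∈ G → A i (suc m) δ ≡ binom n m - s m δ - A (suc i) m δ
            expand δ δ∈ = trans (A-suc i m δ) (cong (_- A (suc i) m δ) (sum-scaled m (s≤s i<p′) δ∈))
            lemma : ∀ g c x y u v → - g * (c - x - u - (c - y - v)) ≡ g * (x - y) + g * (u - v)
            lemma = solve-∀

          a-last : ∀ m → a p′ (suc m) ≡ (+ m - + n) * b m
          a-last m = trans
            (cong (- sign m *_) (cong₂ _-_ (expand 0#) (expand γ)))
            (lemma (sign m) (+ n) (+ m) (s m 0#) (s m γ))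
            where
            expand : ∀ δ → A p′ (suc m) δ ≡ + n * s m δ - + m * s m δ
            -- `A-period` identifies index `p` with index `0`, where `A-first` gives the value: this
            -- closes the chain of indices.
            expand δ = trans (A-suc p′ m δ) (cong₂ _-_ (sum-killed m δ) (trans (A-period m δ) (A-first m δ)))
            lemma : ∀ g n m x y → - g * (n * x - m * x - (n * y - m * y)) ≡ (m - n) * (g * (x - y))
            lemma = solve-∀

          open PeriodicRecurrence p′ n b a b-zero a-zero a-step a-last a-first using (b-closed)

        subsetSums-difference : ∀ m → s m γ ≡ s m 0# - sign m * altSubsetSum m
        subsetSums-difference m = begin
          s m γ                                                  ≡⟨ lemma (s m 0#) (s m γ) ⟩
          s m 0# - 1ℤ * (s m 0# - s m γ)                         ≡⟨ cong (λ t → s m 0# - t * (s m 0# - s m γ)) (sym (sign-square m)) ⟩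
          s m 0# - sign m * sign m * (s m 0# - s m γ)            ≡⟨ cong (λ t → s m 0# - t) (ℤP.*-assoc (sign m) (sign m) _) ⟩
          s m 0# - sign m * b m                                  ≡⟨ cong (λ t → s m 0# - sign m * t) (b-closed m) ⟩
          s m 0# - sign m * altSubsetSum m                       ∎
          where
          lemma : ∀ x y → y ≡ x - 1ℤ * (x - y)
          lemma = solve-∀

      -- By `subsetSums-difference` all n elements of `D` share the value x - y, so the total over
      -- `G` gives x + n (x - y) = C(n, m), which is solved for (n + 1) x.
      subsetSums-0 : ∀ m → + suc n * s m 0# ≡ binom n m + + n * (sign m * altSubsetSum m)
      subsetSums-0 m = begin
        (1ℤ + + n) * x                                  ≡⟨ lemma (+ n) x y ⟩
        x + + n * (x - y) + + n * y                     ≡⟨ cong (λ t → x + t + + n * y) (sym (sumOver-const D (x - y))) ⟩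
        x + sumOver D (λ _ → x - y) + + n * y           ≡⟨ cong (λ t → x + t + + n * y) (sumOver-cong D (λ γ γ∈ → sym (subsetSums-difference γ∈ m))) ⟩
        sumOver G (s m) + + n * y                       ≡⟨ cong (_+ + n * y) (subsetSums-total D there m) ⟩
        binom n m + + n * y                             ∎
        where
        x y : ℤ
        x = s m 0#
        y = sign m * altSubsetSum m
        lemma : ∀ n x y → (1ℤ + n) * x ≡ x + n * (x - y) + n * y
        lemma = solve-∀

      subsetSums-∈D : ∀ m {γ} → γ ∈ D → + suc n * s m γ ≡ binom n m - sign m * altSubsetSum m
      subsetSums-∈D m {γ} γ∈ = begin
        + suc n * s m γ                         ≡⟨ cong (+ suc n *_) (subsetSums-difference γ∈ m) ⟩
        + suc n * (s m 0# - y)                  ≡⟨ ℤP.*-distribˡ-+ (+ suc n) (s m 0#) (- y) ⟩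
        + suc n * s m 0# + + suc n * - y        ≡⟨ cong (_+ + suc n * - y) (subsetSums-0 m) ⟩
        binom n m + + n * y + (1ℤ + + n) * - y  ≡⟨ lemma (binom n m) (+ n) y ⟩
        binom n m - y                           ∎
        where
        y : ℤ
        y = sign m * altSubsetSum m
        lemma : ∀ c n y → c + n * y + (1ℤ + n) * - y ≡ c - y
        lemma = solve-∀

-- Counting monic polynomials by their roots.

length-cartesianProductWith : {A B C : Set} (f : A → B → C) (xs : List A) (ys : List B) →
  length (cartesianProductWith f xs ys) ≡ length xs ℕ.* length ys
length-cartesianProductWith f []       ys = refl
length-cartesianProductWith f (x ∷ xs) ys = trans (ListP.length-++ (map (f x) ys))
  (cong₂ ℕ._+_ (ListP.length-map (f x) ys) (length-cartesianProductWith f xs ys))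

module PolynomialCounting (F : FiniteField) where
  open import Data.Integer using (_+_; _*_; -_; _-_)
  open FieldTheory F
  open Poly F
  open FiniteField F using (size; inverse)
  open AbelianGroupProperties R.+-abelianGroup using (x∙y⁻¹≈ε⇒x≈y; //-rightDividesˡ)
  open SemiringSolver R.commutativeSemiring using (solve; _:=_; _:+_; _:*_; con)

  -- Evaluation and the factor theorem.

  value : Carrier → Pol → Carrier
  value x []      = 0#
  value x (a ∷ g) = a ⊕ x ⊗ value x g

  value-≈ₚ : ∀ x f g → f ≈ₚ g → value x f ≡ value x g
  value-≈ₚ x []      []      _        = refl
  value-≈ₚ x []      (b ∷ g) (b≡0 , eq) = sym (begin
    b ⊕ x ⊗ value x g   ≡⟨ cong₂ (λ u v → u ⊕ x ⊗ v) b≡0 (sym (value-≈ₚ x [] g eq)) ⟩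
    0# ⊕ x ⊗ 0#         ≡⟨ solve 1 (λ x → con 0 :+ x :* con 0 := con 0) refl x ⟩
    0#                  ∎)
  value-≈ₚ x (a ∷ f) []      (a≡0 , eq) = begin
    a ⊕ x ⊗ value x f   ≡⟨ cong₂ (λ u v → u ⊕ x ⊗ v) a≡0 (value-≈ₚ x f [] eq) ⟩
    0# ⊕ x ⊗ 0#         ≡⟨ solve 1 (λ x → con 0 :+ x :* con 0 := con 0) refl x ⟩
    0#                  ∎
  value-≈ₚ x (a ∷ f) (b ∷ g) (a≡b , eq) = cong₂ (λ u v → u ⊕ x ⊗ v) a≡b (value-≈ₚ x f g eq)

  value-+ₚ : ∀ x f g → value x (f +ₚ g) ≡ value x f ⊕ value x g
  value-+ₚ x []      g       = sym (R.+-identityˡ _)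
  value-+ₚ x (a ∷ f) []      = sym (R.+-identityʳ _)
  value-+ₚ x (a ∷ f) (b ∷ g) = trans (cong (λ t → a ⊕ b ⊕ x ⊗ t) (value-+ₚ x f g))
    (solve 5 (λ a b x u v → a :+ b :+ x :* (u :+ v) := a :+ x :* u :+ (b :+ x :* v)) refl a b x _ _)

  value-scale : ∀ x a g → value x (map (a ⊗_) g) ≡ a ⊗ value x g
  value-scale x a []      = sym (R.zeroʳ a)
  value-scale x a (b ∷ g) = trans (cong (λ t → a ⊗ b ⊕ x ⊗ t) (value-scale x a g))
    (solve 4 (λ a b x u → a :* b :+ x :* (a :* u) := a :* (b :+ x :* u)) refl a b x _)

  value-*ₚ : ∀ x f g → value x (f *ₚ g) ≡ value x f ⊗ value x g
  value-*ₚ x []      g = sym (R.zeroˡ _)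
  value-*ₚ x (a ∷ f) g = begin
    value x (map (a ⊗_) g +ₚ (0# ∷ (f *ₚ g)))            ≡⟨ value-+ₚ x (map (a ⊗_) g) (0# ∷ (f *ₚ g)) ⟩
    value x (map (a ⊗_) g) ⊕ (0# ⊕ x ⊗ value x (f *ₚ g)) ≡⟨ cong₂ (λ u v → u ⊕ (0# ⊕ x ⊗ v)) (value-scale x a g) (value-*ₚ x f g) ⟩
    a ⊗ value x g ⊕ (0# ⊕ x ⊗ (value x f ⊗ value x g))   ≡⟨ solve 4 (λ a x u v → a :* v :+ (con 0 :+ x :* (u :* v)) := (a :+ x :* u) :* v) refl a x (value x f) (value x g) ⟩
    (a ⊕ x ⊗ value x f) ⊗ value x g                      ∎

  value-xPlus : ∀ x α → value x (xPlus α) ≡ α ⊕ x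
  value-xPlus x α = cong (α ⊕_) (begin
    x ⊗ (1# ⊕ x ⊗ 0#)   ≡⟨ solve 2 (λ x u → x :* (u :+ x :* con 0) := x :* u) refl x 1# ⟩
    x ⊗ 1#              ≡⟨ R.*-identityʳ x ⟩
    x                   ∎)

  divides⇒root : ∀ α g → xPlus α ∣ₚ g → value (⊖ α) g ≡ 0#
  divides⇒root α g (h , eq) = begin
    value (⊖ α) g                              ≡⟨ sym (value-≈ₚ (⊖ α) (xPlus α *ₚ h) g eq) ⟩
    value (⊖ α) (xPlus α *ₚ h)                 ≡⟨ value-*ₚ (⊖ α) (xPlus α) h ⟩
    value (⊖ α) (xPlus α) ⊗ value (⊖ α) h      ≡⟨ cong (_⊗ value (⊖ α) h) (trans (value-xPlus (⊖ α) α) (R.-‿inverseʳ α)) ⟩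
    0# ⊗ value (⊖ α) h                         ≡⟨ R.zeroˡ _ ⟩
    0#                                         ∎

  coeff : Pol → ℕ → Carrier
  coeff []      i       = 0#
  coeff (a ∷ g) zero    = a
  coeff (a ∷ g) (suc i) = coeff g i

  coeff⇒≈ₚ : ∀ f g → (∀ i → coeff f i ≡ coeff g i) → f ≈ₚ g
  coeff⇒≈ₚ []      []      h = tt
  coeff⇒≈ₚ []      (b ∷ g) h = sym (h 0) , coeff⇒≈ₚ [] g (λ i → h (suc i))
  coeff⇒≈ₚ (a ∷ f) []      h = h 0 , coeff⇒≈ₚ f [] (λ i → h (suc i))
  coeff⇒≈ₚ (a ∷ f) (b ∷ g) h = h 0 , coeff⇒≈ₚ f g (λ i → h (suc i))

  coeff-+ₚ : ∀ f g i → coeff (f +ₚ g) i ≡ coeff f i ⊕ coeff g i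
  coeff-+ₚ []      g       i       = sym (R.+-identityˡ _)
  coeff-+ₚ (a ∷ f) []      i       = sym (R.+-identityʳ _)
  coeff-+ₚ (a ∷ f) (b ∷ g) zero    = refl
  coeff-+ₚ (a ∷ f) (b ∷ g) (suc i) = coeff-+ₚ f g i

  coeff-scale : ∀ a g i → coeff (map (a ⊗_) g) i ≡ a ⊗ coeff g i
  coeff-scale a []      i       = sym (R.zeroʳ a)
  coeff-scale a (b ∷ g) zero    = refl
  coeff-scale a (b ∷ g) (suc i) = coeff-scale a g i

  coeff-xPlus-zero : ∀ α h → coeff (xPlus α *ₚ h) 0 ≡ α ⊗ coeff h 0
  coeff-xPlus-zero α h = begin
    coeff (xPlus α *ₚ h) 0                 ≡⟨ coeff-+ₚ (map (α ⊗_) h) _ 0 ⟩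
    coeff (map (α ⊗_) h) 0 ⊕ 0#            ≡⟨ R.+-identityʳ _ ⟩
    coeff (map (α ⊗_) h) 0                 ≡⟨ coeff-scale α h 0 ⟩
    α ⊗ coeff h 0                          ∎

  coeff-xPlus-suc : ∀ α h i → coeff (xPlus α *ₚ h) (suc i) ≡ α ⊗ coeff h (suc i) ⊕ coeff h i
  coeff-xPlus-suc α h i = begin
    coeff (xPlus α *ₚ h) (suc i)
      ≡⟨ coeff-+ₚ (map (α ⊗_) h) _ (suc i) ⟩
    coeff (map (α ⊗_) h) (suc i) ⊕ coeff (map (1# ⊗_) h +ₚ (0# ∷ [])) i
      ≡⟨ cong₂ _⊕_ (coeff-scale α h (suc i)) (coeff-+ₚ (map (1# ⊗_) h) (0# ∷ []) i) ⟩
    α ⊗ coeff h (suc i) ⊕ (coeff (map (1# ⊗_) h) i ⊕ coeff (0# ∷ []) i)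
      ≡⟨ cong (α ⊗ coeff h (suc i) ⊕_) (cong₂ _⊕_ (trans (coeff-scale 1# h i) (R.*-identityˡ _)) (coeff-0 i)) ⟩
    α ⊗ coeff h (suc i) ⊕ (coeff h i ⊕ 0#)
      ≡⟨ cong (α ⊗ coeff h (suc i) ⊕_) (R.+-identityʳ _) ⟩
    α ⊗ coeff h (suc i) ⊕ coeff h i ∎
    where
    coeff-0 : ∀ i → coeff (0# ∷ []) i ≡ 0#
    coeff-0 zero    = refl
    coeff-0 (suc i) = refl

  -- Synthetic division by X − x, discarding the remainder value x g.
  quotientₚ : Carrier → Pol → Pol
  quotientₚ x []      = []
  quotientₚ x (a ∷ g) = value x g ∷ quotientₚ x g

  value-quotientₚ : ∀ x g → value x g ≡ coeff g 0 ⊕ x ⊗ coeff (quotientₚ x g) 0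
  value-quotientₚ x []      = sym (trans (R.+-identityˡ _) (R.zeroʳ x))
  value-quotientₚ x (a ∷ g) = refl

  -- Identities at a root are first brought to this shape with `x` as a free variable; the relation
  -- x = -α enters only here.
  annihilate : ∀ {α x} → α ⊕ x ≡ 0# → ∀ u v → v ⊕ (α ⊕ x) ⊗ u ≡ v
  annihilate {α} {x} eq u v = begin
    v ⊕ (α ⊕ x) ⊗ u    ≡⟨ cong (λ t → v ⊕ t ⊗ u) eq ⟩
    v ⊕ 0# ⊗ u         ≡⟨ cong (v ⊕_) (R.zeroˡ u) ⟩
    v ⊕ 0#             ≡⟨ R.+-identityʳ v ⟩
    v                  ∎

  -- The discarded remainder affects only the constant coefficient; at all higher ones the product
  -- of X + α with the quotient agrees with `g`.
  coeff-quotientₚ : ∀ {α x} → α ⊕ x ≡ 0# → ∀ g i →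
    α ⊗ coeff (quotientₚ x g) (suc i) ⊕ coeff (quotientₚ x g) i ≡ coeff g (suc i)
  coeff-quotientₚ {α} {x} eq []      i       = trans (R.+-identityʳ _) (R.zeroʳ α)
  coeff-quotientₚ {α} {x} eq (a ∷ g) zero    = begin
    α ⊗ u ⊕ value x g                       ≡⟨ cong (α ⊗ u ⊕_) (value-quotientₚ x g) ⟩
    α ⊗ u ⊕ (coeff g 0 ⊕ x ⊗ u)             ≡⟨ solve 4 (λ α x u c → α :* u :+ (c :+ x :* u) := c :+ (α :+ x) :* u) refl α x u (coeff g 0) ⟩
    coeff g 0 ⊕ (α ⊕ x) ⊗ u                 ≡⟨ annihilate eq u (coeff g 0) ⟩
    coeff g 0                               ∎
    where
    u : Carrier
    u = coeff (quotientₚ x g) 0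
  coeff-quotientₚ eq (a ∷ g) (suc i) = coeff-quotientₚ eq g i

  root⇒divides : ∀ α g → value (⊖ α) g ≡ 0# → xPlus α ∣ₚ g
  root⇒divides α g root = h , coeff⇒≈ₚ (xPlus α *ₚ h) g same
    where
    h : Pol
    h = quotientₚ (⊖ α) g
    same : ∀ i → coeff (xPlus α *ₚ h) i ≡ coeff g i
    same zero = begin
      coeff (xPlus α *ₚ h) 0                        ≡⟨ coeff-xPlus-zero α h ⟩
      α ⊗ coeff h 0                                 ≡⟨ sym (R.+-identityʳ _) ⟩
      α ⊗ coeff h 0 ⊕ 0#                            ≡⟨ cong (α ⊗ coeff h 0 ⊕_) (trans (sym root) (value-quotientₚ (⊖ α) g)) ⟩
      -- Here the root is used: `0#` is replaced by the value of `g`, expanded by one Horner step.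
      α ⊗ coeff h 0 ⊕ (coeff g 0 ⊕ ⊖ α ⊗ coeff h 0) ≡⟨ solve 4 (λ α x u c → α :* u :+ (c :+ x :* u) := c :+ (α :+ x) :* u) refl α (⊖ α) (coeff h 0) (coeff g 0) ⟩
      coeff g 0 ⊕ (α ⊕ ⊖ α) ⊗ coeff h 0             ≡⟨ annihilate (R.-‿inverseʳ α) (coeff h 0) (coeff g 0) ⟩
      coeff g 0                                     ∎
    same (suc i) = trans (coeff-xPlus-suc α h i) (coeff-quotientₚ (R.-‿inverseʳ α) g i)

  -- Multiplying and dividing monic polynomials by a linear factor.

  value-monic : {k : ℕ} → Carrier → Carrier → Vec Carrier k → Carrier
  value-monic x γ c = value x (monicWith γ c)

  -- Adds a constant to the polynomial. It supplies the carry in (X + d)(a + X g) = d a + X (a + (X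
  -- + d) g).
  addHead : {k : ℕ} → Carrier → Vec Carrier (suc k) → Vec Carrier (suc k)
  addHead b (a ∷ c) = (b ⊕ a) ∷ c

  value-addHead : ∀ {k} x γ b (c : Vec Carrier (suc k)) → value-monic x γ (addHead b c) ≡ b ⊕ value-monic x γ c
  value-addHead x γ b (a ∷ c) = R.+-assoc b a _

  -- The free coefficients of (X + d) g, for g = monicWith γ c; the next-to-leading one is γ ⊕ d.
  timesLinear : {k : ℕ} → Carrier → Carrier → Vec Carrier k → Vec Carrier (suc k)
  timesLinear d γ []      = d ⊗ γ ∷ []
  timesLinear d γ (a ∷ c) = d ⊗ a ∷ addHead a (timesLinear d γ c)

  value-timesLinear : ∀ {k} x d γ (c : Vec Carrier k) →
    value-monic x (γ ⊕ d) (timesLinear d γ c) ≡ (d ⊕ x) ⊗ value-monic x γ c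
  value-timesLinear x d γ [] = begin
    d ⊗ γ ⊕ x ⊗ value-monic x (γ ⊕ d) []   ≡⟨ cong (λ t → d ⊗ γ ⊕ x ⊗ t) (value-xPlus x (γ ⊕ d)) ⟩
    d ⊗ γ ⊕ x ⊗ (γ ⊕ d ⊕ x)                ≡⟨ solve 3 (λ x d γ → d :* γ :+ x :* (γ :+ d :+ x) := (d :+ x) :* (γ :+ x)) refl x d γ ⟩
    (d ⊕ x) ⊗ (γ ⊕ x)                      ≡⟨ cong ((d ⊕ x) ⊗_) (sym (value-xPlus x γ)) ⟩
    (d ⊕ x) ⊗ value-monic x γ []           ∎
  value-timesLinear x d γ (a ∷ c) = begin
    d ⊗ a ⊕ x ⊗ value-monic x (γ ⊕ d) (addHead a (timesLinear d γ c))
      ≡⟨ cong (λ t → d ⊗ a ⊕ x ⊗ t) (value-addHead x (γ ⊕ d) a (timesLinear d γ c)) ⟩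
    d ⊗ a ⊕ x ⊗ (a ⊕ value-monic x (γ ⊕ d) (timesLinear d γ c))
      ≡⟨ cong (λ t → d ⊗ a ⊕ x ⊗ (a ⊕ t)) (value-timesLinear x d γ c) ⟩
    d ⊗ a ⊕ x ⊗ (a ⊕ (d ⊕ x) ⊗ value-monic x γ c)
      ≡⟨ solve 4 (λ x d a v → d :* a :+ x :* (a :+ (d :+ x) :* v) := (d :+ x) :* (a :+ x :* v)) refl x d a _ ⟩
    (d ⊕ x) ⊗ (a ⊕ x ⊗ value-monic x γ c) ∎

  -- Synthetic division by X - x on the free coefficients: the quotient's coefficients are the
  -- Horner values of the tails. Here `γ` belongs to the dividend; the next-to-leading coefficient
  -- of the quotient is γ + x.
  overLinear : {k : ℕ} → Carrier → Carrier → Vec Carrier (suc k) → Vec Carrier k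
  overLinear {zero}  x γ _       = []
  overLinear {suc k} x γ (a ∷ c) = value-monic x γ c ∷ overLinear x γ c

  -- The remainder `r` is arbitrary because the tail of a product carries the coefficient `a` as its
  -- own remainder in the induction.
  overLinear-timesLinear : ∀ {k x d} → d ⊕ x ≡ 0# → ∀ γ r (c : Vec Carrier k) →
    overLinear x (γ ⊕ d) (addHead r (timesLinear d γ c)) ≡ c
  overLinear-timesLinear eq γ r [] = refl
  overLinear-timesLinear {x = x} {d} eq γ r (a ∷ c) = cong₂ _∷_ head (overLinear-timesLinear eq γ a c)
    where
    head : value-monic x (γ ⊕ d) (addHead a (timesLinear d γ c)) ≡ a
    head = begin
      value-monic x (γ ⊕ d) (addHead a (timesLinear d γ c))   ≡⟨ value-addHead x (γ ⊕ d) a (timesLinear d γ c) ⟩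
      a ⊕ value-monic x (γ ⊕ d) (timesLinear d γ c)           ≡⟨ cong (a ⊕_) (value-timesLinear x d γ c) ⟩
      a ⊕ (d ⊕ x) ⊗ value-monic x γ c                         ≡⟨ annihilate eq _ a ⟩
      a                                                       ∎

  timesLinear-injective : ∀ {k} d γ {c c′ : Vec Carrier k} → timesLinear d γ c ≡ timesLinear d γ c′ → c ≡ c′
  timesLinear-injective d γ {c} {c′} eq = begin
    c                                                         ≡⟨ sym (overLinear-timesLinear (R.-‿inverseʳ d) γ 0# c) ⟩
    overLinear (⊖ d) (γ ⊕ d) (addHead 0# (timesLinear d γ c))  ≡⟨ cong (λ t → overLinear (⊖ d) (γ ⊕ d) (addHead 0# t)) eq ⟩
    overLinear (⊖ d) (γ ⊕ d) (addHead 0# (timesLinear d γ c′)) ≡⟨ overLinear-timesLinear (R.-‿inverseʳ d) γ 0# c′ ⟩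
    c′                                                        ∎

  -- Division with remainder: the value at `x` is the remainder. For the tail it is also the first
  -- quotient coefficient, which `timesLinear` carries, so the induction hypothesis fits directly.
  timesLinear-overLinear : ∀ {k x d} → d ⊕ x ≡ 0# → ∀ γ (c : Vec Carrier (suc k)) →
    addHead (value-monic x (γ ⊕ d) c) (timesLinear d γ (overLinear x (γ ⊕ d) c)) ≡ c
  timesLinear-overLinear {zero} {x} {d} eq γ (a ∷ []) = cong (_∷ []) (begin
    a ⊕ x ⊗ value-monic x (γ ⊕ d) [] ⊕ d ⊗ γ    ≡⟨ cong (λ t → a ⊕ x ⊗ t ⊕ d ⊗ γ) (value-xPlus x (γ ⊕ d)) ⟩
    a ⊕ x ⊗ (γ ⊕ d ⊕ x) ⊕ d ⊗ γ                 ≡⟨ solve 4 (λ a x d γ → a :+ x :* (γ :+ d :+ x) :+ d :* γ := a :+ (d :+ x) :* (γ :+ x)) refl a x d γ ⟩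
    a ⊕ (d ⊕ x) ⊗ (γ ⊕ x)                       ≡⟨ annihilate eq _ a ⟩
    a                                           ∎)
  timesLinear-overLinear {suc k} {x} {d} eq γ (a ∷ c) = cong₂ _∷_ head (timesLinear-overLinear eq γ c)
    where
    v : Carrier
    v = value-monic x (γ ⊕ d) c
    head : a ⊕ x ⊗ v ⊕ d ⊗ v ≡ a
    head = trans (solve 4 (λ a x d v → a :+ x :* v :+ d :* v := a :+ (d :+ x) :* v) refl a x d v) (annihilate eq v a)

  addHead-zero : ∀ {k} (c : Vec Carrier (suc k)) → addHead 0# c ≡ c
  addHead-zero (a ∷ c) = cong (_∷ c) (R.+-identityˡ a)

  root⇒timesLinear : ∀ {k} d γ (c : Vec Carrier (suc k)) → value-monic (⊖ d) (γ ⊕ d) c ≡ 0# →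
    ∃ λ c′ → c ≡ timesLinear d γ c′
  root⇒timesLinear d γ c root = overLinear (⊖ d) (γ ⊕ d) c , (begin
    c                                                                                ≡⟨ sym (timesLinear-overLinear (R.-‿inverseʳ d) γ c) ⟩
    addHead (value-monic (⊖ d) (γ ⊕ d) c) (timesLinear d γ (overLinear (⊖ d) (γ ⊕ d) c)) ≡⟨ cong (λ t → addHead t (timesLinear d γ (overLinear (⊖ d) (γ ⊕ d) c))) root ⟩
    addHead 0# (timesLinear d γ (overLinear (⊖ d) (γ ⊕ d) c))                         ≡⟨ addHead-zero _ ⟩
    timesLinear d γ (overLinear (⊖ d) (γ ⊕ d) c)                                      ∎)

  noZeroDivisors : ∀ {x y} → x ≢ 0# → x ⊗ y ≡ 0# → y ≡ 0#
  noZeroDivisors {x} {y} x≢0 eq with inverse x x≢0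
  ... | z , xz≡1 = begin
    y              ≡⟨ sym (R.*-identityˡ y) ⟩
    1# ⊗ y         ≡⟨ cong (_⊗ y) (sym xz≡1) ⟩
    x ⊗ z ⊗ y      ≡⟨ solve 3 (λ x z y → x :* z :* y := z :* (x :* y)) refl x z y ⟩
    z ⊗ (x ⊗ y)    ≡⟨ cong (z ⊗_) eq ⟩
    z ⊗ 0#         ≡⟨ R.zeroʳ z ⟩
    0#             ∎

  -- Enumerating field elements and coefficient vectors.

  elements : List Carrier
  elements = map (Inverse.from enum) (allFin size)

  elements-unique : Unique elements
  elements-unique = UniqueP.map⁺ (λ {i} {j} eq → begin
      i                                         ≡⟨ sym (Inverse.strictlyInverseˡ enum i) ⟩
      Inverse.to enum (Inverse.from enum i)     ≡⟨ cong (Inverse.to enum) eq ⟩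
      Inverse.to enum (Inverse.from enum j)     ≡⟨ Inverse.strictlyInverseˡ enum j ⟩
      j                                         ∎) (UniqueP.allFin⁺ size)

  elements-complete : ∀ x → x ∈ elements
  elements-complete x = subst (_∈ elements) (Inverse.strictlyInverseʳ enum x)
    (∈-map⁺ (Inverse.from enum) (∈-allFin (Inverse.to enum x)))

  length-elements : length elements ≡ size
  length-elements = trans (ListP.length-map (Inverse.from enum) (allFin size)) (ListP.length-tabulate (λ i → i))

  vectors : (k : ℕ) → List (Vec Carrier k)
  vectors zero    = [] ∷ []
  vectors (suc k) = cartesianProductWith _∷_ elements (vectors k)

  vectors-unique : ∀ k → Unique (vectors k)
  vectors-unique zero    = [] ∷ []
  vectors-unique (suc k) = UniqueP.cartesianProductWith⁺ _∷_ VecP.∷-injective elements-unique (vectors-unique k)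

  vectors-complete : ∀ {k} (c : Vec Carrier k) → c ∈ vectors k
  vectors-complete []      = here refl
  vectors-complete (a ∷ c) = ∈-cartesianProductWith⁺ _∷_ (elements-complete a) (vectors-complete c)

  length-vectors : ∀ k → length (vectors k) ≡ size ℕ.^ k
  length-vectors zero    = refl
  length-vectors (suc k) = trans (length-cartesianProductWith _∷_ elements (vectors k))
    (cong₂ ℕ._*_ length-elements (length-vectors k))

  -- Root counts and their recurrence in the list.

  isRoot? : ∀ g α → Dec (value (⊖ α) g ≡ 0#)
  isRoot? g α = value (⊖ α) g ≟ 0#

  numRoots : List Carrier → Pol → ℕ
  numRoots L g = length (filter (isRoot? g) L)

  numRoots-cong : ∀ L f g →
    (∀ {α} → α ∈ L → value (⊖ α) f ≡ 0# → value (⊖ α) g ≡ 0#) →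
    (∀ {α} → α ∈ L → value (⊖ α) g ≡ 0# → value (⊖ α) f ≡ 0#) → numRoots L f ≡ numRoots L g
  numRoots-cong []      f g to from = refl
  numRoots-cong (α ∷ L) f g to from with isRoot? f α | isRoot? g α
  ... | yes _  | yes _  = cong suc (numRoots-cong L f g (to ∘ there) (from ∘ there))
  ... | no  _  | no  _  = numRoots-cong L f g (to ∘ there) (from ∘ there)
  ... | yes p  | no ¬q  = contradiction (to (here refl) p) ¬q
  ... | no ¬p  | yes q  = contradiction (from (here refl) q) ¬p

  numRoots-none : ∀ L g → (∀ {α} → α ∈ L → value (⊖ α) g ≢ 0#) → numRoots L g ≡ 0
  numRoots-none []      g none = refl
  numRoots-none (α ∷ L) g none with isRoot? g α
  ... | yes p = contradiction p (none (here refl))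
  ... | no  _ = numRoots-none L g (none ∘ there)

  -- For `α ∈ L` the new factor takes the value d - α at -α, and this is nonzero because `d ∉ L`.
  numRoots-timesLinear : ∀ {k} d γ L → d ∉ L → (c : Vec Carrier k) →
    numRoots L (monicWith (γ ⊕ d) (timesLinear d γ c)) ≡ numRoots L (monicWith γ c)
  numRoots-timesLinear d γ L d∉L c = numRoots-cong L (monicWith (γ ⊕ d) (timesLinear d γ c)) (monicWith γ c)
    (λ {α} α∈ root → noZeroDivisors
      (λ d-α≡0 → d∉L (subst (_∈ L) (sym (x∙y⁻¹≈ε⇒x≈y d α d-α≡0)) α∈))
      (trans (sym (value-timesLinear (⊖ α) d γ c)) root))
    (λ {α} α∈ root → trans (value-timesLinear (⊖ α) d γ c)
      (trans (cong ((d ⊕ ⊖ α) ⊗_) root) (R.zeroʳ _)))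

  polyCount : List Carrier → ℕ → Carrier → ℕ → ℤ
  polyCount L k γ r = sumOver (vectors k) (λ c → indicator (numRoots L (monicWith γ c) ℕP.≟ r))

  -- The first index is the degree; the next coefficient of the only monic polynomial of degree 0 is 0.
  degCount : List Carrier → ℕ → Carrier → ℕ → ℤ
  degCount L zero    γ r = indicator (γ ≟ 0#) * indicator (0 ℕP.≟ r)
  degCount L (suc k) γ r = polyCount L k γ r

  rootCount : Carrier → List Carrier → ℕ → Carrier → ℕ → ℤ
  rootCount d L k γ r = sumOver (vectors k) (λ c →
    indicator (isRoot? (monicWith γ c) d) * indicator (numRoots L (monicWith γ c) ℕP.≟ r))

  -- The only polynomial is X + γ. It has the root -d exactly when γ = d, and then `d ∉ L` excludes
  -- every root from `L`.
  rootCount-zero : ∀ d L γ r → d ∉ L → rootCount d L 0 γ r ≡ degCount L 0 (γ ⊝ d) r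
  rootCount-zero d L γ r d∉L = trans (ℤP.+-identityʳ _) pointwise
    where
    root⇒ : ∀ {α} → value-monic (⊖ α) γ [] ≡ 0# → γ ⊝ α ≡ 0#
    root⇒ {α} eq = trans (sym (value-xPlus (⊖ α) γ)) eq
    pointwise : indicator (isRoot? (monicWith γ []) d) * indicator (numRoots L (monicWith γ []) ℕP.≟ r)
                ≡ indicator (γ ⊝ d ≟ 0#) * indicator (0 ℕP.≟ r)
    pointwise with isRoot? (monicWith γ []) d
    ... | yes root = cong₂ _*_ (sym (indicator-yes (γ ⊝ d ≟ 0#) (root⇒ root)))
      (cong (λ t → indicator (t ℕP.≟ r)) (numRoots-none L (monicWith γ []) none))
      where
      none : ∀ {α} → α ∈ L → value-monic (⊖ α) γ [] ≢ 0#
      none {α} α∈ eq = d∉L (subst (_∈ L) (trans (sym (x∙y⁻¹≈ε⇒x≈y γ α (root⇒ eq))) (x∙y⁻¹≈ε⇒x≈y γ d (root⇒ root))) α∈)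
    ... | no ¬root = trans (ℤP.*-zeroˡ (indicator (numRoots L (monicWith γ []) ℕP.≟ r)))
      (sym (trans (cong (_* indicator (0 ℕP.≟ r)) (indicator-no (γ ⊝ d ≟ 0#) (λ eq → ¬root (trans (value-xPlus (⊖ d) γ) eq))))
                  (ℤP.*-zeroˡ (indicator (0 ℕP.≟ r)))))

  -- `timesLinear d γ` maps all shorter coefficient vectors bijectively onto those with root -d and
  -- leaves the number of roots from `L` unchanged.
  rootCount-suc : ∀ d L k γ r → d ∉ L → rootCount d L (suc k) (γ ⊕ d) r ≡ polyCount L k γ r
  rootCount-suc d L k γ r d∉L = begin
    rootCount d L (suc k) (γ ⊕ d) r
      ≡⟨ sym (sumOver-filter root? (vectors (suc k)) f) ⟩
    sumOver (filter root? (vectors (suc k))) f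
      ≡⟨ sym (sumOver-bijection (vectors-unique k) (UniqueP.filter⁺ root? (vectors-unique (suc k)))
               (timesLinear d γ) (timesLinear-injective d γ) into onto f) ⟩
    sumOver (vectors k) (f ∘ timesLinear d γ)
      ≡⟨ sumOver-cong (vectors k) (λ c _ → cong (λ t → indicator (t ℕP.≟ r)) (numRoots-timesLinear d γ L d∉L c)) ⟩
    polyCount L k γ r ∎
    where
    root? : (c : Vec Carrier (suc k)) → Dec (value-monic (⊖ d) (γ ⊕ d) c ≡ 0#)
    root? c = isRoot? (monicWith (γ ⊕ d) c) d
    f : Vec Carrier (suc k) → ℤ
    f c = indicator (numRoots L (monicWith (γ ⊕ d) c) ℕP.≟ r)
    into : ∀ {c} → c ∈ vectors k → timesLinear d γ c ∈ filter root? (vectors (suc k))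
    into {c} _ = ∈-filter⁺ root? (vectors-complete (timesLinear d γ c))
      (trans (value-timesLinear (⊖ d) d γ c) (trans (cong (_⊗ value-monic (⊖ d) γ c) (R.-‿inverseʳ d)) (R.zeroˡ _)))
    onto : ∀ {c} → c ∈ filter root? (vectors (suc k)) → ∃ λ c′ → c′ ∈ vectors k × c ≡ timesLinear d γ c′
    onto {c} c∈ with root⇒timesLinear d γ c (proj₂ (∈-filter⁻ root? {xs = vectors (suc k)} c∈))
    ... | c′ , eq = c′ , vectors-complete c′ , eq

  rootCount≡degCount : ∀ d L k γ r → d ∉ L → rootCount d L k γ r ≡ degCount L k (γ ⊝ d) r
  rootCount≡degCount d L zero    γ r d∉L = rootCount-zero d L γ r d∉L
  rootCount≡degCount d L (suc k) γ r d∉L =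
    trans (cong (λ δ → rootCount d L (suc k) δ r) (sym (//-rightDividesˡ d γ))) (rootCount-suc d L k (γ ⊝ d) r d∉L)

  indicator-≟-suc : ∀ m n → indicator (suc m ℕP.≟ suc n) ≡ indicator (m ℕP.≟ n)
  indicator-≟-suc m n = indicator-cong (suc m ℕP.≟ suc n) (m ℕP.≟ n) ℕP.suc-injective (cong suc)

  polyCount-∷-zero : ∀ d L k γ → polyCount (d ∷ L) k γ 0 ≡ polyCount L k γ 0 - rootCount d L k γ 0
  polyCount-∷-zero d L k γ = trans (sumOver-cong (vectors k) (λ c _ → pointwise (monicWith γ c)))
    (sumOver-minus (vectors k) _ _)
    where
    pointwise : ∀ g → indicator (numRoots (d ∷ L) g ℕP.≟ 0)
      ≡ indicator (numRoots L g ℕP.≟ 0) - indicator (isRoot? g d) * indicator (numRoots L g ℕP.≟ 0)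
    pointwise g with isRoot? g d
    ... | yes _ = trans (indicator-no (suc (numRoots L g) ℕP.≟ 0) (λ ())) (lemma (indicator (numRoots L g ℕP.≟ 0)))
      where
      lemma : ∀ x → 0ℤ ≡ x - 1ℤ * x
      lemma = solve-∀
    ... | no _ = lemma (indicator (numRoots L g ℕP.≟ 0))
      where
      lemma : ∀ x → x ≡ x - 0ℤ * x
      lemma = solve-∀

  -- Adjoining `d` raises the number of roots by one precisely for polynomials with root -d: those
  -- with `suc r` roots leave the class, those with `r` enter it.
  polyCount-∷-suc : ∀ d L k γ r →
    polyCount (d ∷ L) k γ (suc r) ≡ polyCount L k γ (suc r) - rootCount d L k γ (suc r) + rootCount d L k γ r
  polyCount-∷-suc d L k γ r = trans (sumOver-cong (vectors k) (λ c _ → pointwise (monicWith γ c)))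
    (trans (sumOver-+ (vectors k) _ _)
      (cong (_+ rootCount d L k γ r) (sumOver-minus (vectors k) _ _)))
    where
    pointwise : ∀ g → indicator (numRoots (d ∷ L) g ℕP.≟ suc r)
      ≡ indicator (numRoots L g ℕP.≟ suc r) - indicator (isRoot? g d) * indicator (numRoots L g ℕP.≟ suc r)
        + indicator (isRoot? g d) * indicator (numRoots L g ℕP.≟ r)
    pointwise g with isRoot? g d
    ... | yes _ = trans (indicator-≟-suc (numRoots L g) r)
                        (lemma (indicator (numRoots L g ℕP.≟ suc r)) (indicator (numRoots L g ℕP.≟ r)))
      where
      lemma : ∀ x y → y ≡ x - 1ℤ * x + 1ℤ * y
      lemma = solve-∀
    ... | no _ = lemma (indicator (numRoots L g ℕP.≟ suc r)) (indicator (numRoots L g ℕP.≟ r))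
      where
      lemma : ∀ x y → x ≡ x - 0ℤ * x + 0ℤ * y
      lemma = solve-∀

  -- The integer formula for the counts.

  q : ℤ
  q = + size

  -- The product `sign m * sign r` stands for (-1)^(m-r); for `r > m` the factor `binom m r`
  -- vanishes.
  formula : List Carrier → ℕ → Carrier → ℕ → ℤ
  formula L m γ r = mainTerm q (length L) m r + sign m * sign r * binom m r * subsetSums L m γ

  formula-∷-zero : ∀ d L m γ → formula (d ∷ L) (suc m) γ 0 ≡ formula L (suc m) γ 0 - formula L m (γ ⊝ d) 0
  formula-∷-zero d L m γ = begin
    mainTerm q (suc n) (suc m) 0 + - sign m * 1ℤ * 1ℤ * (s + t)
      ≡⟨ cong (_+ - sign m * 1ℤ * 1ℤ * (s + t)) (mainTerm-zero q n m) ⟩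
    mainTerm q n (suc m) 0 - mainTerm q n m 0 + - sign m * 1ℤ * 1ℤ * (s + t)
      ≡⟨ lemma (mainTerm q n (suc m) 0) (mainTerm q n m 0) (sign m) s t ⟩
    mainTerm q n (suc m) 0 + - sign m * 1ℤ * 1ℤ * s - (mainTerm q n m 0 + sign m * 1ℤ * 1ℤ * t) ∎
    where
    n : ℕ
    n = length L
    s t : ℤ
    s = subsetSums L (suc m) γ
    t = subsetSums L m (γ ⊝ d)
    lemma : ∀ x y g s t → x - y + - g * 1ℤ * 1ℤ * (s + t) ≡ x + - g * 1ℤ * 1ℤ * s - (y + g * 1ℤ * 1ℤ * t)
    lemma = solve-∀

  -- The main terms match by `mainTerm-suc`. In the other term the subsets containing `d` are
  -- distributed over `r` and `suc r` by Pascal's rule for `binom (suc m) (suc r)`.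
  formula-∷-suc : ∀ d L m γ r →
    formula (d ∷ L) (suc m) γ (suc r) ≡ formula L (suc m) γ (suc r) - formula L m (γ ⊝ d) (suc r) + formula L m (γ ⊝ d) r
  formula-∷-suc d L m γ r = begin
    mainTerm q (suc n) (suc m) (suc r) + - g * - h * binom (suc m) (suc r) * (s + t)
      ≡⟨ cong₂ _+_ (mainTerm-suc q n m r) (ℤP.*-distribˡ-+ (- g * - h * binom (suc m) (suc r)) s t) ⟩
    x - y + z + (- g * - h * binom (suc m) (suc r) * s + - g * - h * binom (suc m) (suc r) * t)
      ≡⟨ cong (λ b → x - y + z + (- g * - h * binom (suc m) (suc r) * s + - g * - h * b * t)) (pascal m r) ⟩
    x - y + z + (- g * - h * binom (suc m) (suc r) * s + - g * - h * (binom m r + binom m (suc r)) * t)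
      ≡⟨ lemma x y z g h (binom (suc m) (suc r)) (binom m r) (binom m (suc r)) s t ⟩
    x + - g * - h * binom (suc m) (suc r) * s - (y + g * - h * binom m (suc r) * t) + (z + g * h * binom m r * t) ∎
    where
    n : ℕ
    n = length L
    s t x y z g h : ℤ
    s = subsetSums L (suc m) γ
    t = subsetSums L m (γ ⊝ d)
    x = mainTerm q n (suc m) (suc r)
    y = mainTerm q n m (suc r)
    z = mainTerm q n m r
    g = sign m
    h = sign r
    lemma : ∀ x y z g h b c d s t →
      x - y + z + (- g * - h * b * s + - g * - h * (c + d) * t)
      ≡ x + - g * - h * b * s - (y + g * - h * d * t) + (z + g * h * c * t)
    lemma = solve-∀

  partialT-0 : ∀ k → partialT q 0 (suc k) ≡ + (size ℕ.^ k)
  partialT-0 zero    = cong (_+ 1ℤ) (ℤP.*-zeroʳ q)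
  partialT-0 (suc k) = begin
    q * partialT q 0 (suc k) + - sign k * 0ℤ    ≡⟨ cong₂ _+_ (cong (q *_) (partialT-0 k)) (ℤP.*-zeroʳ (- sign k)) ⟩
    q * + (size ℕ.^ k) + 0ℤ                     ≡⟨ ℤP.+-identityʳ _ ⟩
    q * + (size ℕ.^ k)                          ≡⟨ sym (ℤP.pos-* size (size ℕ.^ k)) ⟩
    + (size ℕ.* size ℕ.^ k)                     ∎

  -- Induction on the list. For the empty list all q^k polynomials have zero listed roots, and the
  -- main term reduces to its summand j = 0.
  polyCount-formula : ∀ L → Unique L → ∀ k γ r → polyCount L k γ r ≡ formula L (suc k) γ r

  -- In degree 0 the main term is an empty sum, and only the empty subset with `r = 0` contributes.
  degCount-formula : ∀ L → Unique L → ∀ m γ r → degCount L m γ r ≡ formula L m γ r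
  degCount-formula L u (suc k) γ r = polyCount-formula L u k γ r
  degCount-formula L u zero γ zero = begin
    x * 1ℤ                                                  ≡⟨ lemma x (binom (length L) 0) ⟩
    binom (length L) 0 * 0ℤ + 1ℤ * 1ℤ * 1ℤ * x              ∎
    where
    x : ℤ
    x = indicator (γ ≟ 0#)
    lemma : ∀ x b → x * 1ℤ ≡ b * 0ℤ + 1ℤ * 1ℤ * 1ℤ * x
    lemma = solve-∀
  degCount-formula L u zero γ (suc r) = lemma (indicator (γ ≟ 0#)) (binom (length L) (suc r)) (sign r)
    where
    lemma : ∀ x b g → x * 0ℤ ≡ b * 0ℤ + 1ℤ * - g * 0ℤ * x
    lemma = solve-∀

  polyCount-formula [] u k γ zero = begin
    sumOver (vectors k) (λ _ → 1ℤ)                     ≡⟨ sumOver-const (vectors k) 1ℤ ⟩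
    + length (vectors k) * 1ℤ                          ≡⟨ cong (λ t → + t * 1ℤ) (length-vectors k) ⟩
    + (size ℕ.^ k) * 1ℤ                                ≡⟨ cong (_* 1ℤ) (sym (partialT-0 k)) ⟩
    partialT q 0 (suc k) * 1ℤ                          ≡⟨ lemma (partialT q 0 (suc k)) (sign k) ⟩
    1ℤ * partialT q 0 (suc k) + - sign k * 1ℤ * 1ℤ * 0ℤ ∎
    where
    lemma : ∀ x g → x * 1ℤ ≡ 1ℤ * x + - g * 1ℤ * 1ℤ * 0ℤ
    lemma = solve-∀
  polyCount-formula [] u k γ (suc r) = trans (sumOver-zero (vectors k) (λ _ _ → refl))
    (lemma (partialT q 0 (k ℕ.∸ r)) (sign k) (sign r) (binom (suc k) (suc r)))
    where
    lemma : ∀ x g h b → 0ℤ ≡ 0ℤ * x + - g * - h * b * 0ℤ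
    lemma = solve-∀
  polyCount-formula (d ∷ L) (d∉ ∷ u) k γ zero = begin
    polyCount (d ∷ L) k γ 0                              ≡⟨ polyCount-∷-zero d L k γ ⟩
    polyCount L k γ 0 - rootCount d L k γ 0              ≡⟨ cong₂ _-_ (polyCount-formula L u k γ 0) (trans (rootCount≡degCount d L k γ 0 (UniqueP.Unique[x∷xs]⇒x∉xs (d∉ ∷ u))) (degCount-formula L u k (γ ⊝ d) 0)) ⟩
    formula L (suc k) γ 0 - formula L k (γ ⊝ d) 0        ≡⟨ sym (formula-∷-zero d L k γ) ⟩
    formula (d ∷ L) (suc k) γ 0                          ∎
  polyCount-formula (d ∷ L) (d∉ ∷ u) k γ (suc r) = begin
    polyCount (d ∷ L) k γ (suc r)
      ≡⟨ polyCount-∷-suc d L k γ r ⟩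
    polyCount L k γ (suc r) - rootCount d L k γ (suc r) + rootCount d L k γ r
      ≡⟨ cong₂ _+_ (cong₂ _-_ (polyCount-formula L u k γ (suc r)) (step (suc r))) (step r) ⟩
    formula L (suc k) γ (suc r) - formula L k (γ ⊝ d) (suc r) + formula L k (γ ⊝ d) r
      ≡⟨ sym (formula-∷-suc d L k γ r) ⟩
    formula (d ∷ L) (suc k) γ (suc r) ∎
    where
    step : ∀ r → rootCount d L k γ r ≡ formula L k (γ ⊝ d) r
    step r = trans (rootCount≡degCount d L k γ r (UniqueP.Unique[x∷xs]⇒x∉xs (d∉ ∷ u))) (degCount-formula L u k (γ ⊝ d) r)

  -- From root counts to the counting predicate of the statement.

  -- Any two duplicate-free lists of the same set are permutations of each other, so the length does
  -- not depend on the witness list.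
  exactlyRoots⇒numRoots : ∀ {D} → Unique D → ∀ g r → ExactlyRootsIn D g r → numRoots D g ≡ r
  exactlyRoots⇒numRoots {D} uD g r (L , uL , mem , len) = trans
    (↭-length (unique-↭ (UniqueP.filter⁺ (isRoot? g) uD) uL to from)) len
    where
    to : ∀ {α} → α ∈ filter (isRoot? g) D → α ∈ L
    to {α} α∈ with ∈-filter⁻ (isRoot? g) {xs = D} α∈
    ... | α∈D , root = Equivalence.to (mem α) (α∈D , root⇒divides α g root)
    from : ∀ {α} → α ∈ L → α ∈ filter (isRoot? g) D
    from {α} α∈ with Equivalence.from (mem α) α∈
    ... | α∈D , div = ∈-filter⁺ (isRoot? g) α∈D (divides⇒root α g div)

  numRoots⇒exactlyRoots : ∀ {D} → Unique D → ∀ g → ExactlyRootsIn D g (numRoots D g)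
  numRoots⇒exactlyRoots {D} uD g = filter (isRoot? g) D , UniqueP.filter⁺ (isRoot? g) uD ,
    (λ α → mk⇔ (λ (α∈D , div) → ∈-filter⁺ (isRoot? g) α∈D (divides⇒root α g div))
               (λ α∈ → let (α∈D , root) = ∈-filter⁻ (isRoot? g) {xs = D} α∈ in α∈D , root⇒divides α g root)) ,
    refl

  formula⇒NIs : ∀ {D} → Unique D → ∀ k γ r {v} →
    (∀ N → + N ≡ formula D (suc k) γ r → ℕ→ℚ N ≡ v) → NIs D k γ r v
  formula⇒NIs {D} uD k γ r eval =
    length found ,
    (found , UniqueP.filter⁺ exact? (vectors-unique k) ,
      (λ c → mk⇔ (λ ex → ∈-filter⁺ exact? (vectors-complete c) (exactlyRoots⇒numRoots uD (monicWith γ c) r ex))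
                 (λ c∈ → subst (ExactlyRootsIn D (monicWith γ c)) (proj₂ (∈-filter⁻ exact? {xs = vectors k} c∈))
                           (numRoots⇒exactlyRoots uD (monicWith γ c)))) ,
      refl) ,
    eval (length found) (trans (length-filter exact? (vectors k)) (polyCount-formula D uD k γ r))
    where
    exact? : (c : Vec Carrier k) → Dec (numRoots D (monicWith γ c) ≡ r)
    exact? c = numRoots D (monicWith γ c) ℕP.≟ r
    found : List (Vec Carrier k)
    found = filter exact? (vectors k)

-- Passage from integers to rationals.

open +-*-Solver using (solve; _:=_; _:+_; _:*_; :-_; con)

ι : ℤ → ℚ
ι z = z ℚ./ 1

-- `ι` reduces its fraction to lowest terms; the homomorphism laws are therefore checked on
-- unnormalised fractions with denominator 1.
toℚᵘ-ι : ∀ z → ℚ.toℚᵘ (ι z) ℚᵘ.≃ mkℚᵘ z 0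
toℚᵘ-ι z = ℚP.toℚᵘ-fromℚᵘ (mkℚᵘ z 0)

ι-+ : ∀ a b → ι (a ℤ.+ b) ≡ ι a ℚ.+ ι b
ι-+ a b = ℚP.toℚᵘ-injective (ℚᵘP.≃-trans (toℚᵘ-ι (a ℤ.+ b)) (ℚᵘP.≃-trans (*≡* (lemma a b))
  (ℚᵘP.≃-sym (ℚᵘP.≃-trans (ℚP.toℚᵘ-homo-+ (ι a) (ι b)) (ℚᵘP.+-cong (toℚᵘ-ι a) (toℚᵘ-ι b))))))
  where
  lemma : ∀ a b → (a ℤ.+ b) ℤ.* 1ℤ ≡ (a ℤ.* 1ℤ ℤ.+ b ℤ.* 1ℤ) ℤ.* 1ℤ
  lemma = solve-∀

ι-* : ∀ a b → ι (a ℤ.* b) ≡ ι a ℚ.* ι b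
ι-* a b = ℚP.toℚᵘ-injective (ℚᵘP.≃-trans (toℚᵘ-ι (a ℤ.* b))
  (ℚᵘP.≃-sym (ℚᵘP.≃-trans (ℚP.toℚᵘ-homo-* (ι a) (ι b)) (ℚᵘP.*-cong (toℚᵘ-ι a) (toℚᵘ-ι b)))))

ι-neg : ∀ a → ι (ℤ.- a) ≡ ℚ.- ι a
ι-neg a = ℚP.toℚᵘ-injective (ℚᵘP.≃-trans (toℚᵘ-ι (ℤ.- a))
  (ℚᵘP.≃-sym (ℚᵘP.≃-trans (ℚP.toℚᵘ-homo‿- (ι a)) (ℚᵘP.-‿cong (toℚᵘ-ι a)))))

ι-≢0 : ∀ {a} → a ≢ 0ℤ → ι a ≢ 0ℚ
ι-≢0 {a} a≢0 eq with ℚᵘP.≃-trans (ℚᵘP.≃-sym (toℚᵘ-ι a)) (ℚᵘP.≃-reflexive (cong ℚ.toℚᵘ eq))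
... | *≡* eq′ = a≢0 (trans (sym (ℤP.*-identityʳ a)) eq′)

*-inv : ∀ {x} → x ≢ 0ℚ → x ℚ.* inv x ≡ 1ℚ
*-inv {x} x≢0 with x ℚP.≟ 0ℚ
... | yes x≡0 = contradiction x≡0 x≢0
... | no  x≢0′ = ℚP.*-inverseʳ x {{ℚ.≢-nonZero x≢0′}}

^ℚ-inverse : ∀ {x y} → x ℚ.* y ≡ 1ℚ → ∀ m → (x ^ℚ m) ℚ.* (y ^ℚ m) ≡ 1ℚ
^ℚ-inverse         eq zero    = refl
^ℚ-inverse {x} {y} eq (suc m) = begin
  x ℚ.* (x ^ℚ m) ℚ.* (y ℚ.* (y ^ℚ m))        ≡⟨ solve 4 (λ x a y b → x :* a :* (y :* b) := x :* y :* (a :* b)) refl x (x ^ℚ m) y (y ^ℚ m) ⟩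
  x ℚ.* y ℚ.* ((x ^ℚ m) ℚ.* (y ^ℚ m))        ≡⟨ cong₂ ℚ._*_ eq (^ℚ-inverse eq m) ⟩
  1ℚ ℚ.* 1ℚ                                  ≡⟨ refl ⟩
  1ℚ                                         ∎

^ℚ-≢0 : ∀ {x} → x ≢ 0ℚ → ∀ m → x ^ℚ m ≢ 0ℚ
^ℚ-≢0 {x} x≢0 m eq = contradiction
  (trans (sym (ℚP.*-zeroˡ (inv x ^ℚ m))) (trans (cong (ℚ._* (inv x ^ℚ m)) (sym eq)) (^ℚ-inverse (*-inv x≢0) m)))
  (λ ())

sgn-sign : ∀ m → sgn (+ m) ≡ ι (sign m)
sgn-sign zero    = refl
sgn-sign (suc m) = begin
  ℚ.- 1ℚ ℚ.* sgn (+ m)      ≡⟨ cong (ℚ.- 1ℚ ℚ.*_) (sgn-sign m) ⟩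
  ℚ.- 1ℚ ℚ.* ι (sign m)     ≡⟨ solve 1 (λ x → con (ℚ.- 1ℚ) :* x := :- x) refl (ι (sign m)) ⟩
  ℚ.- ι (sign m)            ≡⟨ sym (ι-neg (sign m)) ⟩
  ι (ℤ.- sign m)            ∎

neg-^ℚ : ∀ x m → ι (sign m) ℚ.* ((ℚ.- x) ^ℚ m) ≡ x ^ℚ m
neg-^ℚ x zero    = refl
neg-^ℚ x (suc m) = begin
  ι (ℤ.- sign m) ℚ.* (ℚ.- x ℚ.* ((ℚ.- x) ^ℚ m))   ≡⟨ cong (ℚ._* (ℚ.- x ℚ.* ((ℚ.- x) ^ℚ m))) (ι-neg (sign m)) ⟩
  ℚ.- ι (sign m) ℚ.* (ℚ.- x ℚ.* ((ℚ.- x) ^ℚ m))   ≡⟨ solve 3 (λ s x y → :- s :* (:- x :* y) := x :* (s :* y)) refl (ι (sign m)) x ((ℚ.- x) ^ℚ m) ⟩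
  x ℚ.* (ι (sign m) ℚ.* ((ℚ.- x) ^ℚ m))           ≡⟨ cong (x ℚ.*_) (neg-^ℚ x m) ⟩
  x ℚ.* (x ^ℚ m)                                  ∎

neg-≢0 : ∀ {x} → x ≢ 0ℚ → ℚ.- x ≢ 0ℚ
neg-≢0 x≢0 eq = x≢0 (ℚP.neg-injective eq)

-- This cancellation turns the newest summand, with its negative power of -q, into an integer.
^ℚ-*-inv-neg : ∀ {x} → x ≢ 0ℚ → ∀ m → (x ^ℚ m) ℚ.* inv ((ℚ.- x) ^ℚ m) ≡ ι (sign m)
^ℚ-*-inv-neg {x} x≢0 m = begin
  (x ^ℚ m) ℚ.* inv y                   ≡⟨ cong (ℚ._* inv y) (sym (neg-^ℚ x m)) ⟩
  ι (sign m) ℚ.* y ℚ.* inv y           ≡⟨ ℚP.*-assoc (ι (sign m)) y (inv y) ⟩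
  ι (sign m) ℚ.* (y ℚ.* inv y)         ≡⟨ cong (ι (sign m) ℚ.*_) (*-inv (^ℚ-≢0 (neg-≢0 x≢0) m)) ⟩
  ι (sign m) ℚ.* 1ℚ                    ≡⟨ ℚP.*-identityʳ _ ⟩
  ι (sign m)                           ∎
  where
  y : ℚ
  y = (ℚ.- x) ^ℚ m

-- Induction on `l`: the extra factor q multiplies the earlier sum as in the recursion of
-- `partialT`, and the new last summand becomes a signed binomial coefficient.
partialT-rational : ∀ {q} → q ≢ 0 → ∀ a l →
  (ℕ→ℚ q ^ℚ l) ℚ.* sumTerms (suc l) (λ j → ((ℚ.- ℕ→ℚ q) ^ℤ (ℤ.- (+ j))) ℚ.* ℕ→ℚ (a C j)) ≡ ι (partialT (+ q) a (suc l))
partialT-rational {q} q≢0 a zero = sym (cong (λ t → ι (t ℤ.+ 1ℤ)) (ℤP.*-zeroʳ (+ q)))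
partialT-rational {q} q≢0 a (suc l) = begin
  X ℚ.* (X ^ℚ l) ℚ.* (S ℚ.+ Y ℚ.* c)
    ≡⟨ solve 5 (λ X Z S Y c → X :* Z :* (S :+ Y :* c) := X :* (Z :* S) :+ X :* Z :* Y :* c) refl X (X ^ℚ l) S Y c ⟩
  X ℚ.* ((X ^ℚ l) ℚ.* S) ℚ.+ X ℚ.* (X ^ℚ l) ℚ.* Y ℚ.* c
    ≡⟨ cong₂ (λ u v → X ℚ.* u ℚ.+ v ℚ.* c) (partialT-rational q≢0 a l) (^ℚ-*-inv-neg X≢0 (suc l)) ⟩
  X ℚ.* ι (partialT (+ q) a (suc l)) ℚ.+ ι (sign (suc l)) ℚ.* c
    ≡⟨ cong₂ ℚ._+_ (sym (ι-* (+ q) (partialT (+ q) a (suc l)))) (sym (ι-* (sign (suc l)) (binom a (suc l)))) ⟩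
  ι (+ q ℤ.* partialT (+ q) a (suc l)) ℚ.+ ι (sign (suc l) ℤ.* binom a (suc l))
    ≡⟨ sym (ι-+ (+ q ℤ.* partialT (+ q) a (suc l)) (sign (suc l) ℤ.* binom a (suc l))) ⟩
  ι (partialT (+ q) a (suc (suc l))) ∎
  where
  X S Y c : ℚ
  X = ℕ→ℚ q
  S = sumTerms (suc l) (λ j → ((ℚ.- ℕ→ℚ q) ^ℤ (ℤ.- (+ j))) ℚ.* ℕ→ℚ (a C j))
  Y = inv ((ℚ.- X) ^ℚ suc l)
  c = ℕ→ℚ (a C suc l)
  X≢0 : X ≢ 0ℚ
  X≢0 = ι-≢0 (λ eq → q≢0 (ℤP.+-injective eq))

Tval-mainTerm : ∀ {q} → q ≢ 0 → ∀ n k r → Tval q n k r ≡ ι (mainTerm (+ q) n (suc k) r)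
Tval-mainTerm {q} q≢0 n k r with r ℕP.≤? k
... | yes r≤k = begin
  (X ^ℤ (k ℤ.⊖ r)) ℚ.* c ℚ.* sumTerms (suc k ℕ.∸ r) f
    ≡⟨ cong₂ (λ u v → (X ^ℤ u) ℚ.* c ℚ.* sumTerms v f) (ℤP.⊖-≥ r≤k) l≡ ⟩
  (X ^ℚ (k ℕ.∸ r)) ℚ.* c ℚ.* sumTerms (suc (k ℕ.∸ r)) f
    ≡⟨ solve 3 (λ x c s → x :* c :* s := c :* (x :* s)) refl (X ^ℚ (k ℕ.∸ r)) c _ ⟩
  c ℚ.* ((X ^ℚ (k ℕ.∸ r)) ℚ.* sumTerms (suc (k ℕ.∸ r)) f)
    ≡⟨ cong (c ℚ.*_) (partialT-rational q≢0 (n ℕ.∸ r) (k ℕ.∸ r)) ⟩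
  c ℚ.* ι (partialT (+ q) (n ℕ.∸ r) (suc (k ℕ.∸ r)))
    ≡⟨ cong (λ t → c ℚ.* ι (partialT (+ q) (n ℕ.∸ r) t)) (sym l≡) ⟩
  c ℚ.* ι (partialT (+ q) (n ℕ.∸ r) (suc k ℕ.∸ r))
    ≡⟨ sym (ι-* (binom n r) _) ⟩
  ι (mainTerm (+ q) n (suc k) r) ∎
  where
  X c : ℚ
  X = ℕ→ℚ q
  c = ℕ→ℚ (n C r)
  f : ℕ → ℚ
  f j = ((ℚ.- X) ^ℤ (ℤ.- (+ j))) ℚ.* ℕ→ℚ ((n ℕ.∸ r) C j)
  l≡ : suc k ℕ.∸ r ≡ suc (k ℕ.∸ r)
  l≡ = ℕP.+-∸-assoc 1 r≤k
-- For `r > k` the sum is empty, so both sides are `0` whatever the negative power of q.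
... | no r≰k = begin
  x ℚ.* sumTerms (suc k ℕ.∸ r) f                                 ≡⟨ cong (λ t → x ℚ.* sumTerms t f) l≡ ⟩
  x ℚ.* 0ℚ                                                       ≡⟨ ℚP.*-zeroʳ x ⟩
  ι 0ℤ                                                           ≡⟨ cong ι (sym (ℤP.*-zeroʳ (binom n r))) ⟩
  ι (binom n r ℤ.* partialT (+ q) (n ℕ.∸ r) 0)                   ≡⟨ cong (λ t → ι (binom n r ℤ.* partialT (+ q) (n ℕ.∸ r) t)) (sym l≡) ⟩
  ι (mainTerm (+ q) n (suc k) r)                                 ∎
  where
  x : ℚ
  x = (ℕ→ℚ q ^ℤ (k ℤ.⊖ r)) ℚ.* ℕ→ℚ (n C r)
  f : ℕ → ℚ
  f j = ((ℚ.- ℕ→ℚ q) ^ℤ (ℤ.- (+ j))) ℚ.* ℕ→ℚ ((n ℕ.∸ r) C j)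
  l≡ : suc k ℕ.∸ r ≡ 0
  l≡ = ℕP.m≤n⇒m∸n≡0 (ℕP.≰⇒> r≰k)

sign-∸ : ∀ {m r} → r ℕ.≤ m → sign (m ℕ.∸ r) ≡ sign m ℤ.* sign r
sign-∸ {m} {r} r≤m = begin
  sign (m ℕ.∸ r)                                  ≡⟨ sym (ℤP.*-identityʳ _) ⟩
  sign (m ℕ.∸ r) ℤ.* 1ℤ                           ≡⟨ cong (sign (m ℕ.∸ r) ℤ.*_) (sym (sign-square r)) ⟩
  sign (m ℕ.∸ r) ℤ.* (sign r ℤ.* sign r)          ≡⟨ sym (ℤP.*-assoc (sign (m ℕ.∸ r)) (sign r) (sign r)) ⟩
  sign (m ℕ.∸ r) ℤ.* sign r ℤ.* sign r            ≡⟨ cong (ℤ._* sign r) (sym (sign-+ (m ℕ.∸ r) r)) ⟩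
  sign (m ℕ.∸ r ℕ.+ r) ℤ.* sign r                 ≡⟨ cong (λ t → sign t ℤ.* sign r) (ℕP.m∸n+n≡m r≤m) ⟩
  sign m ℤ.* sign r                               ∎

aTerm : ℕ → ℕ → ℕ → ℤ
aTerm n m r = sign m ℤ.* sign r ℤ.* binom m r ℤ.* binom n m

-- The count produces C(m, r) C(n, m); `binom-trinomial` converts it into the product of the
-- statement.
Aval-aTerm : ∀ n k r → Aval n k r ≡ inv (ℕ→ℚ (suc n)) ℚ.* ι (aTerm n (suc k) r)
Aval-aTerm n k r with r ℕP.≤? suc k
... | yes r≤m = begin
  i ℚ.* sgn (m ℤ.⊖ r) ℚ.* c ℚ.* ℕ→ℚ (binomℤ (n ℕ.∸ r) (m ℤ.⊖ r))
    ≡⟨ cong (λ t → i ℚ.* sgn t ℚ.* c ℚ.* ℕ→ℚ (binomℤ (n ℕ.∸ r) t)) (ℤP.⊖-≥ r≤m) ⟩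
  i ℚ.* sgn (+ (m ℕ.∸ r)) ℚ.* c ℚ.* d
    ≡⟨ cong (λ t → i ℚ.* t ℚ.* c ℚ.* d) (trans (sgn-sign (m ℕ.∸ r)) (cong ι (sign-∸ r≤m))) ⟩
  i ℚ.* ι g ℚ.* c ℚ.* d
    ≡⟨ solve 4 (λ i g c d → i :* g :* c :* d := i :* (g :* (c :* d))) refl i (ι g) c d ⟩
  i ℚ.* (ι g ℚ.* (c ℚ.* d))
    ≡⟨ cong (λ t → i ℚ.* (ι g ℚ.* t)) (sym (ι-* (binom n r) (binom (n ℕ.∸ r) (m ℕ.∸ r)))) ⟩
  i ℚ.* (ι g ℚ.* ι (binom n r ℤ.* binom (n ℕ.∸ r) (m ℕ.∸ r)))
    ≡⟨ cong (i ℚ.*_) (sym (ι-* g _)) ⟩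
  i ℚ.* ι (g ℤ.* (binom n r ℤ.* binom (n ℕ.∸ r) (m ℕ.∸ r)))
    ≡⟨ cong (λ t → i ℚ.* ι (g ℤ.* t)) (sym (binom-trinomial n m r r≤m)) ⟩
  i ℚ.* ι (g ℤ.* (binom n m ℤ.* binom m r))
    ≡⟨ cong (λ t → i ℚ.* ι t) (lemma g (binom n m) (binom m r)) ⟩
  i ℚ.* ι (aTerm n m r) ∎
  where
  m : ℕ
  m = suc k
  i c d : ℚ
  i = inv (ℕ→ℚ (suc n))
  c = ℕ→ℚ (n C r)
  d = ℕ→ℚ ((n ℕ.∸ r) C (m ℕ.∸ r))
  g : ℤ
  g = sign m ℤ.* sign r
  lemma : ∀ g x y → g ℤ.* (x ℤ.* y) ≡ g ℤ.* y ℤ.* x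
  lemma = solve-∀
... | no r≰m = begin
  -- `∸-suc` exposes `m ⊖ r` as a negative constructor, on which `binomℤ` is `0`.
  x ℚ.* ℕ→ℚ (binomℤ (n ℕ.∸ r) (m ℤ.⊖ r))                ≡⟨ cong (λ t → x ℚ.* ℕ→ℚ (binomℤ (n ℕ.∸ r) t)) (trans (ℤP.⊖-< m<r) (cong (λ t → ℤ.- (+ t)) (∸-suc m<r))) ⟩
  x ℚ.* 0ℚ                                              ≡⟨ ℚP.*-zeroʳ x ⟩
  0ℚ                                                    ≡⟨ sym (ℚP.*-zeroʳ i) ⟩
  i ℚ.* ι 0ℤ                                            ≡⟨ cong (λ t → i ℚ.* ι t) (lemma (sign m ℤ.* sign r) (binom n m)) ⟩
  i ℚ.* ι (sign m ℤ.* sign r ℤ.* 0ℤ ℤ.* binom n m)      ≡⟨ cong (λ t → i ℚ.* ι (sign m ℤ.* sign r ℤ.* t ℤ.* binom n m)) (sym (binom-> m<r)) ⟩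
  i ℚ.* ι (aTerm n m r)                                 ∎
  where
  m : ℕ
  m = suc k
  m<r : m ℕ.< r
  m<r = ℕP.≰⇒> r≰m
  i x : ℚ
  i = inv (ℕ→ℚ (suc n))
  x = i ℚ.* sgn (m ℤ.⊖ r) ℚ.* ℕ→ℚ (n C r)
  lemma : ∀ g y → 0ℤ ≡ g ℤ.* 0ℤ ℤ.* y
  lemma = solve-∀

altSum-rational : ∀ M j → sumTerms (suc j) (λ i → sgn (+ i) ℚ.* ℕ→ℚ (M C i)) ≡ ι (altSum M j)
altSum-rational M zero    = refl
altSum-rational M (suc j) = begin
  sumTerms (suc j) (λ i → sgn (+ i) ℚ.* ℕ→ℚ (M C i)) ℚ.+ sgn (+ suc j) ℚ.* ℕ→ℚ (M C suc j)
    ≡⟨ cong₂ (λ u v → u ℚ.+ v ℚ.* ℕ→ℚ (M C suc j)) (altSum-rational M j) (sgn-sign (suc j)) ⟩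
  ι (altSum M j) ℚ.+ ι (sign (suc j)) ℚ.* ι (binom M (suc j))
    ≡⟨ cong (ι (altSum M j) ℚ.+_) (sym (ι-* (sign (suc j)) (binom M (suc j)))) ⟩
  ι (altSum M j) ℚ.+ ι (sign (suc j) ℤ.* binom M (suc j))
    ≡⟨ sym (ι-+ (altSum M j) _) ⟩
  ι (altSum M (suc j)) ∎

bTerm : (p′ n m r : ℕ) → ℤ
bTerm p′ n m r = sign r ℤ.* binom m r ℤ.* altSum (suc n ℕ./ suc p′) (m ℕ./ suc p′)

Bval-bTerm : ∀ p′ n k r → Bval (suc p′) n k r ≡ ι (bTerm p′ n (suc k) r)
Bval-bTerm p′ n k r = begin
  sgn (+ r) ℚ.* ℕ→ℚ (suc k C r) ℚ.* sumTerms (suc (suc k ℕ./ suc p′)) (λ j → sgn (+ j) ℚ.* ℕ→ℚ ((suc n ℕ./ suc p′) C j))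
    ≡⟨ cong₂ (λ u v → u ℚ.* ℕ→ℚ (suc k C r) ℚ.* v) (sgn-sign r) (altSum-rational (suc n ℕ./ suc p′) (suc k ℕ./ suc p′)) ⟩
  ι (sign r) ℚ.* ι (binom (suc k) r) ℚ.* ι S
    ≡⟨ cong (ℚ._* ι S) (sym (ι-* (sign r) (binom (suc k) r))) ⟩
  ι (sign r ℤ.* binom (suc k) r) ℚ.* ι S
    ≡⟨ sym (ι-* (sign r ℤ.* binom (suc k) r) S) ⟩
  ι (bTerm p′ n (suc k) r) ∎
  where
  S : ℤ
  S = altSum (suc n ℕ./ suc p′) (suc k ℕ./ suc p′)

divide : ∀ n {u v} → + suc n ℤ.* u ≡ v → ι u ≡ inv (ℕ→ℚ (suc n)) ℚ.* ι v
divide n {u} {v} eq = begin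
  ι u                             ≡⟨ sym (ℚP.*-identityˡ (ι u)) ⟩
  1ℚ ℚ.* ι u                      ≡⟨ cong (ℚ._* ι u) (sym (*-inv {x} (ι-≢0 {+ suc n} (λ ())))) ⟩
  x ℚ.* inv x ℚ.* ι u             ≡⟨ solve 3 (λ x y u → x :* y :* u := y :* (x :* u)) refl x (inv x) (ι u) ⟩
  inv x ℚ.* (x ℚ.* ι u)           ≡⟨ cong (inv x ℚ.*_) (trans (sym (ι-* (+ suc n) u)) (cong ι eq)) ⟩
  inv x ℚ.* ι v                   ∎
  where
  x : ℚ
  x = ℕ→ℚ (suc n)

-- Assembling the three cases.

open import Data.Rational using (_+_; _-_; _*_)
open FiniteField using (Carrier; 0#; size; natElt)
open Poly using (NIs)

module SubgroupCount (F : FiniteField) (p′ : ℕ) (prime-p : Prime (suc p′)) (char : natElt F (suc p′) ≡ 0# F)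
  (D : List (Carrier F)) (uniqueD : Unique D) (0∉D : 0# F ∉ D) (subgroup : D∪0IsAddSubgroup F D)
  (k r : ℕ) where
  open FieldTheory F using (subsetSums; module Subgroup)
  open Subgroup D uniqueD 0∉D subgroup using (subsetSums-outside; module Characteristic)
  open Characteristic p′ prime-p char using (subsetSums-0; subsetSums-∈D; altSubsetSum)
  open PolynomialCounting F using (formula; formula⇒NIs)

  private
    n m : ℕ
    n = length D
    m = suc k
    T i : ℚ
    T = Tval (size F) n k r
    i = inv (ℕ→ℚ (suc n))
    mt at bt σ S : ℤ
    mt = mainTerm (+ size F) n m r
    at = aTerm n m r
    bt = bTerm p′ n m r
    σ = sign m ℤ.* sign r ℤ.* binom m r
    S = altSubsetSum m

  size≢0 : size F ≢ 0
  size≢0 eq with subst Fin eq (Inverse.to (FiniteField.enum F) (0# F))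
  ... | ()

  T-rational : T ≡ ι mt
  T-rational = Tval-mainTerm size≢0 n k r

  -- The sign (-1)^m occurs once in `σ` and once in the subset-sum formula; the two cancel and leave
  -- the (-1)^r of the statement.
  σ-sign : ∀ c → σ ℤ.* (c ℤ.* (sign m ℤ.* S)) ≡ c ℤ.* bt
  σ-sign c = begin
    sign m ℤ.* sign r ℤ.* binom m r ℤ.* (c ℤ.* (sign m ℤ.* S))      ≡⟨ lemma (sign m) (sign r) (binom m r) c S ⟩
    sign m ℤ.* sign m ℤ.* (c ℤ.* (sign r ℤ.* binom m r ℤ.* S))      ≡⟨ cong (ℤ._* (c ℤ.* bt)) (sign-square m) ⟩
    1ℤ ℤ.* (c ℤ.* bt)                                               ≡⟨ ℤP.*-identityˡ _ ⟩
    c ℤ.* bt                                                        ∎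
    where
    lemma : ∀ g h b c s → g ℤ.* h ℤ.* b ℤ.* (c ℤ.* (g ℤ.* s)) ≡ g ℤ.* g ℤ.* (c ℤ.* (h ℤ.* b ℤ.* s))
    lemma = solve-∀

  -- Cases (a) and (c) at once: `c` is -1 for `γ ∈ D` and `n` for γ = 0. The computation stays in ℤ,
  -- multiplied by n + 1, until `divide`.
  count-in-subgroup : ∀ γ c → + suc n ℤ.* subsetSums D m γ ≡ binom n m ℤ.+ c ℤ.* (sign m ℤ.* S) →
    ∀ N → + N ≡ formula D m γ r → ℕ→ℚ N ≡ T + i * ι at + ι c * i * ι bt
  count-in-subgroup γ c eq N count = begin
    ι (+ N)                              ≡⟨ cong ι count ⟩
    ι (mt ℤ.+ σ ℤ.* s)                   ≡⟨ ι-+ mt (σ ℤ.* s) ⟩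
    ι mt + ι (σ ℤ.* s)                   ≡⟨ cong₂ _+_ (sym T-rational) (divide n scaled) ⟩
    T + i * ι (at ℤ.+ c ℤ.* bt)          ≡⟨ cong (λ t → T + i * t) (trans (ι-+ at (c ℤ.* bt)) (cong (λ u → ι at + u) (ι-* c bt))) ⟩
    T + i * (ι at + ι c * ι bt)          ≡⟨ solve 5 (λ T i a c b → T :+ i :* (a :+ c :* b) := T :+ i :* a :+ c :* i :* b) refl T i (ι at) (ι c) (ι bt) ⟩
    T + i * ι at + ι c * i * ι bt        ∎
    where
    s : ℤ
    s = subsetSums D m γ
    scaled : + suc n ℤ.* (σ ℤ.* s) ≡ at ℤ.+ c ℤ.* bt
    scaled = begin
      + suc n ℤ.* (σ ℤ.* s)                             ≡⟨ lemma (+ suc n) σ s ⟩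
      σ ℤ.* (+ suc n ℤ.* s)                             ≡⟨ cong (σ ℤ.*_) eq ⟩
      σ ℤ.* (binom n m ℤ.+ c ℤ.* (sign m ℤ.* S))        ≡⟨ ℤP.*-distribˡ-+ σ (binom n m) _ ⟩
      at ℤ.+ σ ℤ.* (c ℤ.* (sign m ℤ.* S))               ≡⟨ +-congˡ at (σ-sign c) ⟩
      at ℤ.+ c ℤ.* bt                                   ∎
      where
      lemma : ∀ a b c → a ℤ.* (b ℤ.* c) ≡ b ℤ.* (a ℤ.* c)
      lemma = solve-∀

  count-∈D : ∀ γ → γ ∈ D → NIs F D k γ r (T + Aval n k r - i * Bval (suc p′) n k r)
  count-∈D γ γ∈ = formula⇒NIs uniqueD k γ r (λ N count → begin
    ℕ→ℚ N                                      ≡⟨ count-in-subgroup γ -1ℤ (trans (subsetSums-∈D m γ∈) (lemma (binom n m) (sign m ℤ.* S))) N count ⟩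
    T + i * ι at + ι -1ℤ * i * ι bt            ≡⟨ solve 4 (λ T a i b → T :+ a :+ con (ι -1ℤ) :* i :* b := T :+ a :+ :- (i :* b)) refl T (i * ι at) i (ι bt) ⟩
    T + i * ι at - i * ι bt                    ≡⟨ cong₂ (λ a b → T + a - i * b) (sym (Aval-aTerm n k r)) (sym (Bval-bTerm p′ n k r)) ⟩
    T + Aval n k r - i * Bval (suc p′) n k r   ∎)
    where
    lemma : ∀ x y → x ℤ.- y ≡ x ℤ.+ -1ℤ ℤ.* y
    lemma = solve-∀

  count-zero : ∀ γ → γ ≡ 0# F → NIs F D k γ r (T + Aval n k r + (ℕ→ℚ n * i) * Bval (suc p′) n k r)
  count-zero γ refl = formula⇒NIs uniqueD k γ r (λ N count →
    trans (count-in-subgroup γ (+ n) (subsetSums-0 m) N count)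
      (cong₂ (λ a b → T + a + ℕ→ℚ n * i * b) (sym (Aval-aTerm n k r)) (sym (Bval-bTerm p′ n k r))))

  count-outside : ∀ γ → γ ∉ D → γ ≢ 0# F → NIs F D k γ r T
  count-outside γ γ∉ γ≢0 = formula⇒NIs uniqueD k γ r (λ N count → begin
    ι (+ N)                                  ≡⟨ cong ι count ⟩
    ι (mt ℤ.+ σ ℤ.* subsetSums D m γ)        ≡⟨ cong (λ t → ι (mt ℤ.+ σ ℤ.* t)) (subsetSums-outside D there m (λ { (here eq) → γ≢0 eq ; (there γ∈) → γ∉ γ∈ })) ⟩
    ι (mt ℤ.+ σ ℤ.* 0ℤ)                      ≡⟨ cong ι (lemma mt σ) ⟩
    ι mt                                     ≡⟨ sym T-rational ⟩
    T                                        ∎)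
    where
    lemma : ∀ x y → x ℤ.+ y ℤ.* 0ℤ ≡ x
    lemma = solve-∀

theorem3 : (F : FiniteField) →
    (p e : ℕ) → Prime p → 1 ≤ e → size F ≡ p ^ e → natElt F p ≡ 0# F →
    (D : List (Carrier F)) → Unique D → 0# F ∉ D → D∪0IsAddSubgroup F D →
    (k r : ℕ) (γ : Carrier F) →
    (γ ∈ D →
    NIs F D k γ r (Tval (size F) (length D) k r + Aval (length D) k r
    - inv (ℕ→ℚ (suc (length D))) * Bval p (length D) k r))
    × (γ ∉ D → γ ≢ 0# F →
    NIs F D k γ r (Tval (size F) (length D) k r))
    × (γ ≡ 0# F →
    NIs F D k γ r (Tval (size F) (length D) k r + Aval (length D) k r
    + (ℕ→ℚ (length D) * inv (ℕ→ℚ (suc (length D)))) * Bval p (length D) k r))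
-- Excluding `0` gives `p` the form `suc p′`, on which the floor division in `Bval` reduces.
theorem3 F zero     e prime-p = contradiction prime-p ¬prime[0]
theorem3 F (suc p′) e prime-p _ _ char D uniqueD 0∉D subgroup k r γ =
  count-∈D γ , count-outside γ , count-zero γ
  where open SubgroupCount F p′ prime-p char D uniqueD 0∉D subgroup k r
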